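{- Let $k\geqslant 3$. There exist constants $c_1,c_2>0$ depending only on $k$ such that for every prime $N>k$, every $1\leqslant m\leqslant N$ and every $a>0$, \[ \mathbb{P}\big(|D^k(B_m)|>a\big)\leqslant N^{c_1}\exp\left(-c_2\frac{a}{m}\right). \]
   Context: For $N$ prime, a $k$-term arithmetic progression ($k$-progression) in $\mathbb{Z}/N\mathbb{Z}$ is a set $\{x,x+d,\dots,x+(k-1)d\}$ with $x\in\mathbb{Z}/N\mathbb{Z}$ and $d\in\{1,\dots,(N-1)/2\}$. $B_m$ is a uniformly random $m$-element subset of $\mathbb{Z}/N\mathbb{Z}$, $N^k(B_m)$ is the number of $k$-progressions contained in $B_m$, and $D^k(B_m)=N^k(B_m)-\mathbb{E}[N^k(B_m)]$. -}

module Defs where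

open import Data.Nat using (ℕ; zero; suc; _+_; _*_; _∸_; _^_; _≤_; _<_; _<?_; ∣_-_∣)
open import Data.Nat.DivMod using (_/_; _mod_)
open import Data.Bool using (Bool; true; false)
open import Data.Fin using (Fin; toℕ)
open import Data.Vec using (Vec; []; _∷_; lookup)
open import Data.List using (List; []; _∷_; [_]; map; _++_; filter; length; upTo; allFin)
open import Data.Nat.ListAction using (sum; product)
open import Data.Fin.Subset using (Subset; inside; outside; ∣_∣)
open import Data.Nat using (_≟_)

allSubsets : (n : ℕ) → List (Subset n)
allSubsets zero = [ [] ]
allSubsets (suc n) = map (inside ∷_) (allSubsets n) ++ map (outside ∷_) (allSubsets n)

subsetsOfSize : (N m : ℕ) → List (Subset N)
subsetsOfSize N m = filter (λ s → ∣ s ∣ ≟ m) (allSubsets N)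

indicator : Bool → ℕ
indicator true = 1
indicator false = 0

apIn : (k n : ℕ) → Subset (suc n) → Fin (suc n) → ℕ → ℕ
apIn k n s x d = product (map (λ j → indicator (lookup s ((toℕ x + j * d) mod (suc n)))) (upTo k))

-- N^k(s): number of k-progressions {x, x+d, ..., x+(k-1)d}, x ∈ ℤ/Nℤ, d ∈ {1,…,(N-1)/2}, contained in s
numAP : (k N : ℕ) → Subset N → ℕ
numAP k zero s = 0
numAP k (suc n) s =
  sum (map (λ x → sum (map (λ d → apIn k n s x (suc d)) (upTo (n / 2)))) (allFin (suc n)))

numSubsets : (N m : ℕ) → ℕ
numSubsets N m = length (subsetsOfSize N m)

-- T = Σ_s N^k(s), so E[N^k(B_m)] = T / C
totalAP : (k N m : ℕ) → ℕ
totalAP k N m = sum (map (numAP k N) (subsetsOfSize N m))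

-- number of m-subsets s with |D^k(s)| > p/q, i.e. q·|C·N^k(s) − T| > p·C
-- (so  P(|D^k(B_m)| > p/q) = badCount k N m p q / numSubsets N m)
badCount : (k N m p q : ℕ) → ℕ
badCount k N m p q =
  length (filter (λ s → p * numSubsets N m <? q * ∣ numSubsets N m * numAP k N s - totalAP k N m ∣)
                 (subsetsOfSize N m))

{-# OPTIONS --safe #-}
module Submission where

-- Write t = m / N.  Since m is the mode of the binomial distribution, passing from uniform
-- m-subsets to t-random subsets costs a factor N + 1 only.  Reveal the coordinates one by one
-- and put f = 1_B - t.  The Doob decomposition of the number X of progressions contained in B is
-- X - E X = Σ_x f(x) G_x, and the predictable G_x decomposes in turn as G_x = ρ + Σ_y f(y) M_xy.
-- Every element lies in equally many progressions, so ρ does not depend on x and disappears from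
-- X - E X, because Σ_x f(x) = 0 when |B| = m; two elements lie in at most k² common progressions,
-- so |M_xy| ≤ k².  Products Π (1 + λ f(x) G_x) over predictable G have expectation 1, so Markov's
-- inequality bounds first all the |G_x - ρ| by about √(a m) and then |X - E X| by about a, each time
-- with exceptional probability at most N^O(1) exp(-Ω(a / m)).  Finally, the mean over m-subsets
-- replaces E X: if it were far from E X, then a deviation from E X would have probability at least
-- N^-O(1), and the claim would be trivial.

open import Defs
open import Data.Bool using (Bool; true; false)
open import Data.Empty using (⊥-elim)
open import Data.Fin using (Fin; zero; suc; toℕ)
open import Data.Fin.Properties as Fin using (toℕ-injective; toℕ<n; toℕ-fromℕ<)
open import Data.Fin.Subset using (Subset) renaming (∣_∣ to size)
open import Data.Fin.Subset.Properties using (∣p∣≤n)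
open import Data.List using (List; []; _∷_; map; _++_; length; replicate; filter; foldr; allFin; tabulate; upTo; applyUpTo; cartesianProduct)
open import Data.List.Membership.Propositional using (_∈_)
open import Data.List.Membership.Propositional.Properties using (∈-allFin)
open import Data.List.Properties using (length-tabulate; map-∘; filter-none; length-filter)
open import Data.List.Relation.Unary.All as All using (All; []; _∷_)
open import Data.List.Relation.Unary.All.Properties using (all-filter)
open import Data.List.Relation.Unary.Any using (here; there)
open import Data.List.Relation.Unary.Unique.Propositional using (Unique; []; _∷_)
open import Data.List.Relation.Unary.Unique.Propositional.Properties using (allFin⁺; cartesianProduct⁺)
open import Data.Nat.ListAction using (sum; product)
open import Data.Nat.Primality using (Prime; euclidsLemma)
open import Data.Nat.Tactic.RingSolver using (solve-∀)
open import Data.Product using (Σ; ∃; _×_; _,_; proj₁; proj₂)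
open import Data.Sum using (_⊎_; inj₁; inj₂)
open import Data.Vec using (Vec; []; _∷_; head; tail; lookup; _[_]≔_)
import Data.Vec as Vec
open import Relation.Binary.PropositionalEquality using (_≡_; _≢_; refl; sym; trans; cong; cong₂; subst; subst₂)
open import Relation.Nullary using (¬_; Dec; yes; no)
open import Relation.Unary using (Decidable)

-- The thresholds come from balancing two levels at the same cost 2^-A, where A is about a / (k² m).
-- The increments of G_x are f(y) M_xy with |M_xy| ≤ k², and Σ f² ≤ m on m-sets, so G_x - ρ stays
-- within about k² √(mA). With that as the size of the integrand, X - E X stays within about √(m ·
-- k⁴ mA · A) = k² mA, which is a. Without removing ρ the integrand would be of the size of a mean
-- degree, and the second step would lose too much. Every factor 1 + λ f G has to stay away from 0,
-- which limits λ and thereby requires A ≤ m. Beyond that range the worst-case deviation 4 k² m²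
-- already lies below the threshold. Products of factors 1 + u in place of exponentials keep the
-- argument inside ℚ: their expectation is exactly 1, and that a product is at least 2^A follows
-- from the inequality of arithmetic and geometric means. The remaining real exponent p / (q m K)
-- disappears by raising the final inequality to the power q m K.

module ModularArithmetic where

  -- Terms of arithmetic progressions modulo a prime

  open import Data.Nat
  open import Data.Nat.DivMod
  open import Data.Nat.Divisibility
  open import Data.Nat.Properties

  %≡⇒∣ : ∀ a b n .{{_ : NonZero n}} → a % n ≡ b % n → n ∣ ∣ a - b ∣
  %≡⇒∣ a b n eq = divides ∣ a / n - b / n ∣ (trans
    (cong₂ ∣_-_∣ (m≡m%n+[m/n]*n a n) (trans (m≡m%n+[m/n]*n b n) (cong (_+ b / n * n) (sym eq))))
    (trans (∣m+n-m+o∣≡∣n-o∣ (a % n) (a / n * n) (b / n * n)) (sym (*-distribʳ-∣-∣ n (a / n) (b / n)))))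

  ∣∣-∣⇒≡ : ∀ {a b n} → a < n → b < n → n ∣ ∣ a - b ∣ → a ≡ b
  ∣∣-∣⇒≡ {a} {b} {n} a<n b<n n∣ with ∣ a - b ∣ in eq
  ... | zero = ∣m-n∣≡0⇒m≡n eq
  ... | suc _ = ⊥-elim (<⇒≱ (≤-<-trans (≤-reflexive (sym eq)) (≤-<-trans (∣m-n∣≤m⊔n a b) (⊔-lub a<n b<n))) (∣⇒≤ n∣))

  -- The factorisation (i - j)(a - b), with sums on both sides because subtraction on ℕ truncates.
  -- Either order of `i` and `j` reduces it to an additive identity.
  ∣-∣-cross : ∀ i j a b → ∣ (i * a + j * b) - (j * a + i * b) ∣ ≡ ∣ i - j ∣ * ∣ a - b ∣
  ∣-∣-cross i j a b with ≤-total i j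
  ... | inj₁ i≤j = trans (ordered i (j ∸ i) a b (m+[n∸m]≡n i≤j)) (cong (_* ∣ a - b ∣) (sym (m≤n⇒∣m-n∣≡n∸m i≤j)))
    where
    ordered : ∀ i c a b {j} → i + c ≡ j → ∣ (i * a + j * b) - (j * a + i * b) ∣ ≡ c * ∣ a - b ∣
    ordered i c a b refl = trans (cong₂ ∣_-_∣ (lhs i c a b) (rhs i c a b))
      (trans (∣m+n-m+o∣≡∣n-o∣ (i * a + i * b) (c * b) (c * a)) (trans (sym (*-distribˡ-∣-∣ c b a)) (cong (c *_) (∣-∣-comm b a))))
      where
      lhs : ∀ i c a b → i * a + (i + c) * b ≡ i * a + i * b + c * b
      lhs = solve-∀
      rhs : ∀ i c a b → (i + c) * a + i * b ≡ i * a + i * b + c * a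
      rhs = solve-∀
  ... | inj₂ j≤i = trans (ordered j (i ∸ j) a b (m+[n∸m]≡n j≤i)) (cong (_* ∣ a - b ∣) (sym (m≤n⇒∣n-m∣≡n∸m j≤i)))
    where
    ordered : ∀ j c a b {i} → j + c ≡ i → ∣ (i * a + j * b) - (j * a + i * b) ∣ ≡ c * ∣ a - b ∣
    ordered j c a b refl = trans (cong₂ ∣_-_∣ (lhs j c a b) (rhs j c a b))
      (trans (∣m+n-m+o∣≡∣n-o∣ (j * a + j * b) (c * a) (c * b)) (sym (*-distribˡ-∣-∣ c a b)))
      where
      lhs : ∀ j c a b → (j + c) * a + j * b ≡ j * a + j * b + c * a
      lhs = solve-∀
      rhs : ∀ j c a b → j * a + (j + c) * b ≡ j * a + j * b + c * b
      rhs = solve-∀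

  term : ∀ {n} → Fin (suc n) → ℕ → ℕ → Fin (suc n)
  term {n} x e j = (toℕ x + j * e) mod (suc n)

  toℕ-term : ∀ {n} (x : Fin (suc n)) e j → toℕ (term x e j) ≡ (toℕ x + j * e) % suc n
  toℕ-term {n} x e j = toℕ-fromℕ< (m%n<n (toℕ x + j * e) (suc n))

  term≡⇒ : ∀ {n} {x u : Fin (suc n)} {e j} → term x e j ≡ u → (toℕ x + j * e) % suc n ≡ toℕ u
  term≡⇒ {x = x} {e = e} {j} eq = trans (sym (toℕ-term x e j)) (cong toℕ eq)

  +%-cong : ∀ {a a′ b b′} n .{{_ : NonZero n}} → a % n ≡ a′ % n → b % n ≡ b′ % n → (a + b) % n ≡ (a′ + b′) % n
  +%-cong {a} {a′} {b} {b′} n eq eq′ = trans (%-distribˡ-+ a b n)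
    (trans (cong₂ (λ x y → (x + y) % n) eq eq′) (sym (%-distribˡ-+ a′ b′ n)))

  module _ {n : ℕ} where

    term-injective-x : ∀ {x x′ : Fin (suc n)} e j → term x e j ≡ term x′ e j → x ≡ x′
    term-injective-x {x} {x′} e j eq = toℕ-injective (∣∣-∣⇒≡ (toℕ<n x) (toℕ<n x′) (subst (suc n ∣_)
      (trans (cong₂ ∣_-_∣ (+-comm (toℕ x) (j * e)) (+-comm (toℕ x′) (j * e))) (∣m+n-m+o∣≡∣n-o∣ (j * e) (toℕ x) (toℕ x′)))
      (%≡⇒∣ (toℕ x + j * e) (toℕ x′ + j * e) (suc n) (trans (term≡⇒ {x = x} {e = e} {j} eq) (toℕ-term x′ e j)))))

    term-surjective-x : ∀ (u : Fin (suc n)) e j → Σ (Fin (suc n)) λ x → term x e j ≡ u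
    term-surjective-x u e j = x , toℕ-injective (trans (toℕ-term x e j) (trans
      (+%-cong {toℕ x} {toℕ u + n * (j * e)} {j * e} {j * e} (suc n) (trans (cong (_% suc n) (toℕ-fromℕ< (m%n<n (toℕ u + n * (j * e)) (suc n)))) (m%n%n≡m%n (toℕ u + n * (j * e)) (suc n))) refl)
      (trans (cong (_% suc n) (lemma (toℕ u) n (j * e))) (trans ([m+kn]%n≡m%n (toℕ u) (j * e) (suc n)) (m<n⇒m%n≡m (toℕ<n u))))))
      where
      -- Since n ≡ -1 modulo n + 1, this is u - j e.
      x = (toℕ u + n * (j * e)) mod (suc n)
      lemma : ∀ u n c → u + n * c + c ≡ u + c * suc n
      lemma = solve-∀

    module _ (N-prime : Prime (suc n)) where

      ∣*⇒ : ∀ {a b} → suc n ∣ a * b → b < suc n → b ≢ 0 → suc n ∣ a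
      ∣*⇒ {a} {b} div b<n b≢0 with euclidsLemma a b N-prime div
      ... | inj₁ ∣a = ∣a
      ... | inj₂ ∣b = ⊥-elim (<⇒≱ b<n (∣⇒≤ {{≢-nonZero b≢0}} ∣b))

      term-injective-j : ∀ {x : Fin (suc n)} {e i j} → e < suc n → e ≢ 0 → i < suc n → j < suc n →
        term x e i ≡ term x e j → i ≡ j
      term-injective-j {x} {e} {i} {j} e<n e≢0 i<n j<n eq = ∣∣-∣⇒≡ i<n j<n (∣*⇒ {∣ i - j ∣} {e} (subst (suc n ∣_)
        (trans (∣m+n-m+o∣≡∣n-o∣ (toℕ x) (i * e) (j * e)) (sym (*-distribʳ-∣-∣ e i j)))
        (%≡⇒∣ (toℕ x + i * e) (toℕ x + j * e) (suc n) (trans (term≡⇒ {x = x} {e = e} {i} eq) (toℕ-term x e j)))) e<n e≢0)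

      -- Adding the congruences crosswise cancels `x` and `x′` without subtraction and leaves i e +
      -- j e′ ≡ j e + i e′. So the prime divides (i - j)(e - e′), and i - j is a nonzero residue.
      two-terms-determine-difference : ∀ {x x′ u v : Fin (suc n)} {e e′ i j} → e < suc n → e′ < suc n →
        i < suc n → j < suc n → i ≢ j →
        term x e i ≡ u → term x e j ≡ v → term x′ e′ i ≡ u → term x′ e′ j ≡ v → e ≡ e′
      two-terms-determine-difference {x} {x′} {u} {v} {e} {e′} {i} {j} e<n e′<n i<n j<n i≢j p q p′ q′ =
        ∣∣-∣⇒≡ e<n e′<n (∣*⇒ {∣ e - e′ ∣} {∣ i - j ∣}
          (subst (suc n ∣_) (trans (∣m+n-m+o∣≡∣n-o∣ X (i * e + j * e′) (j * e + i * e′)) (trans (∣-∣-cross i j e e′) (*-comm ∣ i - j ∣ ∣ e - e′ ∣)))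
            (%≡⇒∣ (X + (i * e + j * e′)) (X + (j * e + i * e′)) (suc n) congruent))
          (≤-<-trans (∣m-n∣≤m⊔n i j) (⊔-lub i<n j<n)) (λ eq → i≢j (∣m-n∣≡0⇒m≡n eq)))
        where
        X = toℕ x + toℕ x′
        interchange : ∀ a b c d → a + c + (b + d) ≡ a + b + (c + d)
        interchange = solve-∀
        congruent : (X + (i * e + j * e′)) % suc n ≡ (X + (j * e + i * e′)) % suc n
        congruent = trans (cong (_% suc n) (sym (interchange (toℕ x) (toℕ x′) (i * e) (j * e′))))
          (trans (+%-cong {toℕ x + i * e} {toℕ x′ + i * e′} {toℕ x′ + j * e′} {toℕ x + j * e} (suc n) (trans (term≡⇒ {x = x} {e = e} {i} p) (sym (term≡⇒ {x = x′} {e = e′} {i} p′)))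
                                  (trans (term≡⇒ {x = x′} {e = e′} {j} q′) (sym (term≡⇒ {x = x} {e = e} {j} q))))
          (cong (_% suc n) (swap (toℕ x) (toℕ x′) (i * e′) (j * e))))
          where
          swap : ∀ a b c d → b + c + (a + d) ≡ a + b + (d + c)
          swap = solve-∀

module Deviation where

  open import Data.Nat as ℕ using (ℕ; zero; suc)
  import Data.Nat.DivMod as ℕ
  import Data.Nat.Properties as ℕ
  open import Data.Rational
  open import Data.Rational.Properties
  open import Data.Rational.Solver using (module +-*-Solver)
  open +-*-Solver using (solve; con; _:+_; _:*_; _:-_; :-_; _:=_)
  open ModularArithmetic

  -- Ordered arithmetic in ℚ and the embedding of ℕ

  2ℚ : ℚ
  2ℚ = 1ℚ + 1ℚ

  ≤-by : ∀ {p q} e → 0ℚ ≤ e → q ≡ p + e → p ≤ q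
  ≤-by {p} {q} e 0≤e q≡p+e = subst₂ _≤_ (+-identityʳ p) (sym q≡p+e) (+-monoʳ-≤ p 0≤e)

  p≤q⇒0≤q-p : ∀ {p q} → p ≤ q → 0ℚ ≤ q - p
  p≤q⇒0≤q-p {p} {q} p≤q = subst (_≤ q - p) (+-inverseʳ p) (+-monoˡ-≤ (- p) p≤q)

  0≤1 : 0ℚ ≤ 1ℚ
  0≤1 = nonNegative⁻¹ 1ℚ

  0≤+ : ∀ {p q} → 0ℚ ≤ p → 0ℚ ≤ q → 0ℚ ≤ p + q
  0≤+ 0≤p 0≤q = +-mono-≤ 0≤p 0≤q

  *-monoʳ : ∀ {r p q} → 0ℚ ≤ r → p ≤ q → r * p ≤ r * q
  *-monoʳ {r} 0≤r p≤q = *-monoˡ-≤-nonNeg r {{nonNegative 0≤r}} p≤q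

  *-monoˡ : ∀ {r p q} → 0ℚ ≤ r → p ≤ q → p * r ≤ q * r
  *-monoˡ {r} 0≤r p≤q = *-monoʳ-≤-nonNeg r {{nonNegative 0≤r}} p≤q

  0≤* : ∀ {p q} → 0ℚ ≤ p → 0ℚ ≤ q → 0ℚ ≤ p * q
  0≤* {p} {q} 0≤p 0≤q = subst (_≤ p * q) (*-zeroʳ p) (*-monoʳ 0≤p 0≤q)

  *-mono : ∀ {p p′ q q′} → 0ℚ ≤ p → 0ℚ ≤ q′ → p ≤ p′ → q ≤ q′ → p * q ≤ p′ * q′
  *-mono 0≤p 0≤q′ p≤p′ q≤q′ = ≤-trans (*-monoʳ 0≤p q≤q′) (*-monoˡ 0≤q′ p≤p′)

  *-cancelʳ : ∀ {r p q} → 0ℚ < r → p * r ≤ q * r → p ≤ q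
  *-cancelʳ {r} 0<r = *-cancelʳ-≤-pos r {{positive 0<r}}

  ∣p∣*∣p∣≡p*p : ∀ p → ∣ p ∣ * ∣ p ∣ ≡ p * p
  ∣p∣*∣p∣≡p*p p with ∣p∣≡p∨∣p∣≡-p p
  ... | inj₁ eq = cong₂ _*_ eq eq
  ... | inj₂ eq = trans (cong₂ _*_ eq eq) (solve 1 (λ x → :- x :* :- x := x :* x) refl p)

  0≤p*p : ∀ p → 0ℚ ≤ p * p
  0≤p*p p = subst (0ℚ ≤_) (∣p∣*∣p∣≡p*p p) (0≤* (0≤∣p∣ p) (0≤∣p∣ p))

  p≤∣p∣ : ∀ p → p ≤ ∣ p ∣
  p≤∣p∣ p with ≤-total 0ℚ p
  ... | inj₁ 0≤p = ≤-reflexive (sym (0≤p⇒∣p∣≡p 0≤p))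
  ... | inj₂ p≤0 = ≤-trans p≤0 (0≤∣p∣ p)

  -∣p∣≤p : ∀ p → - ∣ p ∣ ≤ p
  -∣p∣≤p p = subst (_≤ p) (cong -_ (∣-p∣≡∣p∣ p))
    (subst (- ∣ - p ∣ ≤_) (solve 1 (λ x → :- (:- x) := x) refl p) (neg-antimono-≤ (p≤∣p∣ (- p))))

  p*p≤b*b : ∀ {p b} → ∣ p ∣ ≤ b → p * p ≤ b * b
  p*p≤b*b {p} {b} ∣p∣≤b = subst (_≤ b * b) (∣p∣*∣p∣≡p*p p)
    (*-mono (0≤∣p∣ p) (≤-trans (0≤∣p∣ p) ∣p∣≤b) ∣p∣≤b ∣p∣≤b)

  -- Defined by recursion so that `ι (suc n)` is `1ℚ + ι n` by computation; the ring solver can then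
  -- treat `ι n` as a variable.
  ι : ℕ → ℚ
  ι zero = 0ℚ
  ι (suc n) = 1ℚ + ι n

  0≤ι : ∀ n → 0ℚ ≤ ι n
  0≤ι zero = ≤-refl
  0≤ι (suc n) = 0≤+ 0≤1 (0≤ι n)

  0<ι : ∀ {n} → 1 ℕ.≤ n → 0ℚ < ι n
  0<ι {suc n} _ = <-≤-trans (positive⁻¹ 1ℚ)
    (≤-by (ι n) (0≤ι n) refl)

  ι-+ : ∀ m n → ι (m ℕ.+ n) ≡ ι m + ι n
  ι-+ zero n = sym (+-identityˡ (ι n))
  ι-+ (suc m) n = trans (cong (1ℚ +_) (ι-+ m n)) (sym (+-assoc 1ℚ (ι m) (ι n)))

  ι-* : ∀ m n → ι (m ℕ.* n) ≡ ι m * ι n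
  ι-* zero n = sym (*-zeroˡ (ι n))
  ι-* (suc m) n = trans (ι-+ n (m ℕ.* n)) (trans (cong (ι n +_) (ι-* m n))
    (solve 2 (λ a b → b :+ a :* b := (con 1ℚ :+ a) :* b) refl (ι m) (ι n)))

  ι-mono : ∀ {m n} → m ℕ.≤ n → ι m ≤ ι n
  ι-mono {n = n} ℕ.z≤n = 0≤ι n
  ι-mono (ℕ.s≤s m≤n) = +-monoʳ-≤ 1ℚ (ι-mono m≤n)

  ι-mono-< : ∀ {m n} → m ℕ.< n → ι m < ι n
  ι-mono-< {m} {n} m<n = <-≤-trans
    (subst (_< ι (suc m)) (+-identityˡ (ι m)) (+-monoˡ-< (ι m) (positive⁻¹ 1ℚ))) (ι-mono m<n)

  ι-cancel-≤ : ∀ {m n} → ι m ≤ ι n → m ℕ.≤ n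
  ι-cancel-≤ {m} {n} ιm≤ιn with m ℕ.≤? n
  ... | yes m≤n = m≤n
  ... | no m≰n = ⊥-elim (<-irrefl refl (<-≤-trans (ι-mono-< (ℕ.≰⇒> m≰n)) ιm≤ιn))

  -- The later parameters t, c and μ are quotients. They are used only through the defining equation
  -- given here, so that all identities stay polynomial.
  quotient : ∀ a n → 1 ℕ.≤ n → Σ ℚ λ x → x * ι n ≡ a
  quotient a n 1≤n = a * (1/ ι n) {{nz}} , trans (*-assoc a _ (ι n))
    (trans (cong (a *_) (*-inverseˡ (ι n) {{nz}})) (*-identityʳ a))
    where
    nz : NonZero (ι n)
    nz = pos⇒nonZero (ι n) {{positive (0<ι 1≤n)}}

  0≤quotient : ∀ {a n x} → 1 ℕ.≤ n → x * ι n ≡ a → 0ℚ ≤ a → 0ℚ ≤ x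
  0≤quotient {a} {n} {x} 1≤n eq 0≤a = *-cancelʳ (0<ι 1≤n)
    (subst₂ _≤_ (sym (*-zeroˡ (ι n))) (sym eq) 0≤a)

  -- The inequality of arithmetic and geometric means

  pow : ℚ → ℕ → ℚ
  pow a zero = 1ℚ
  pow a (suc n) = a * pow a n

  0≤pow : ∀ {a} n → 0ℚ ≤ a → 0ℚ ≤ pow a n
  0≤pow zero _ = 0≤1
  0≤pow (suc n) 0≤a = 0≤* 0≤a (0≤pow n 0≤a)

  pow-* : ∀ a b n → pow (a * b) n ≡ pow a n * pow b n
  pow-* a b zero = refl
  pow-* a b (suc n) rewrite pow-* a b n =
    solve 4 (λ a b x y → a :* b :* (x :* y) := a :* x :* (b :* y)) refl a b (pow a n) (pow b n)

  pow-mono : ∀ {a b} n → 0ℚ ≤ a → a ≤ b → pow a n ≤ pow b n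
  pow-mono zero _ _ = ≤-refl
  pow-mono (suc n) 0≤a a≤b = *-mono 0≤a (0≤pow n (≤-trans 0≤a a≤b)) a≤b (pow-mono n 0≤a a≤b)

  0<pow : ∀ {a} n → 0ℚ < a → 0ℚ < pow a n
  0<pow zero _ = positive⁻¹ 1ℚ
  0<pow {a} (suc n) 0<a = subst (_< a * pow a n) (*-zeroʳ a)
    (*-monoʳ-<-pos a {{positive 0<a}} (0<pow n 0<a))

  -- The graph of x ↦ xⁿ⁺¹ lies above its tangent line at a.
  pow-tangent : ∀ {a b} n → 0ℚ ≤ a → 0ℚ ≤ b →
    ι (suc n) * (pow a n * b) ≤ pow b (suc n) + ι n * pow a (suc n)
  pow-tangent {a} {b} zero 0≤a 0≤b = ≤-reflexive
    (solve 2 (λ a b → (con 1ℚ :+ con 0ℚ) :* (con 1ℚ :* b) := b :* con 1ℚ :+ con 0ℚ :* (a :* con 1ℚ)) refl a b)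
  pow-tangent {a} {b} (suc n) 0≤a 0≤b = ≤-by
    (b * (B + ι n * (a * A) - (1ℚ + ι n) * (A * b)) + (1ℚ + ι n) * (A * ((b - a) * (b - a))))
    (0≤+ (0≤* 0≤b (p≤q⇒0≤q-p (pow-tangent n 0≤a 0≤b)))
         (0≤* (0≤ι (suc n)) (0≤* (0≤pow n 0≤a) (0≤p*p (b - a)))))
    (solve 5 (λ a b i A B → b :* B :+ (con 1ℚ :+ i) :* (a :* (a :* A)) :=
        (con 1ℚ :+ (con 1ℚ :+ i)) :* (a :* A :* b) :+
        (b :* (B :+ i :* (a :* A) :- (con 1ℚ :+ i) :* (A :* b)) :+ (con 1ℚ :+ i) :* (A :* ((b :- a) :* (b :- a)))))
      refl a b (ι n) A B)
    where
    A = pow a n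
    B = pow b (suc n)

  sumℚ : List ℚ → ℚ
  sumℚ [] = 0ℚ
  sumℚ (x ∷ xs) = x + sumℚ xs

  prodℚ : List ℚ → ℚ
  prodℚ [] = 1ℚ
  prodℚ (x ∷ xs) = x * prodℚ xs

  0≤sumℚ : ∀ {xs} → All (0ℚ ≤_) xs → 0ℚ ≤ sumℚ xs
  0≤sumℚ [] = ≤-refl
  0≤sumℚ (0≤x ∷ 0≤xs) = 0≤+ 0≤x (0≤sumℚ 0≤xs)

  -- This is `pow-tangent` at (n + 1) X, evaluated at n (X + x): the means X / n and (X + x) / (n +
  -- 1), both multiplied by n (n + 1). A common factor n cancels, hence the separate case n = 0.
  am-gm-step : ∀ n {X x} → 0ℚ ≤ X → 0ℚ ≤ x →
    pow (ι (suc n)) (suc n) * (x * pow X n) ≤ pow (ι n) n * pow (X + x) (suc n)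
  am-gm-step zero {X} {x} 0≤X 0≤x = ≤-by X 0≤X
    (solve 2 (λ X x → con 1ℚ :* ((X :+ x) :* con 1ℚ) := (con 1ℚ :+ con 0ℚ) :* con 1ℚ :* (x :* con 1ℚ) :+ X) refl X x)
  am-gm-step n@(suc _) {X} {x} 0≤X 0≤x = *-cancelʳ (0<ι {n} (ℕ.s≤s ℕ.z≤n)) (≤-by _ (p≤q⇒0≤q-p tangent) eq)
    where
    j = ι n
    i = ι (suc n)
    tangent = pow-tangent n (0≤* (0≤ι (suc n)) 0≤X) (0≤* (0≤ι n) (0≤+ 0≤X 0≤x))
    eq : pow j n * pow (X + x) (suc n) * j ≡ pow i (suc n) * (x * pow X n) * j
         + (pow (j * (X + x)) (suc n) + j * pow (i * X) (suc n) - i * (pow (i * X) n * (j * (X + x))))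
    eq rewrite pow-* i X n | pow-* j (X + x) n =
      solve 7 (λ j J Y I X P x → J :* ((X :+ x) :* Y) :* j :=
         (con 1ℚ :+ j) :* I :* (x :* P) :* j :+
         (j :* (X :+ x) :* (J :* Y) :+ j :* ((con 1ℚ :+ j) :* X :* (I :* P)) :- (con 1ℚ :+ j) :* (I :* P :* (j :* (X :+ x)))))
        refl j (pow j n) (pow (X + x) n) (pow i n) X (pow X n) x

  am-gm : ∀ {xs} → All (0ℚ ≤_) xs →
    pow (ι (length xs)) (length xs) * prodℚ xs ≤ pow (sumℚ xs) (length xs)
  am-gm [] = ≤-refl
  am-gm {x ∷ xs} (0≤x ∷ 0≤xs) = *-cancelʳ (0<pow-ι n) (begin
    pow i (suc n) * (x * P) * J   ≡⟨ solve 4 (λ I x P J → I :* (x :* P) :* J := I :* (x :* (J :* P))) refl (pow i (suc n)) x P J ⟩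
    pow i (suc n) * (x * (J * P)) ≤⟨ *-monoʳ (0≤pow (suc n) (0≤ι (suc n))) (*-monoʳ 0≤x (am-gm 0≤xs)) ⟩
    pow i (suc n) * (x * pow X n) ≤⟨ am-gm-step n (0≤sumℚ 0≤xs) 0≤x ⟩
    J * pow (X + x) (suc n)       ≡⟨ cong (λ z → J * pow z (suc n)) (+-comm X x) ⟩
    J * pow (x + X) (suc n)       ≡⟨ *-comm J (pow (x + X) (suc n)) ⟩
    pow (x + X) (suc n) * J       ∎)
    where
    open ≤-Reasoning
    n = length xs
    i = ι (suc n)
    P = prodℚ xs
    X = sumℚ xs
    J = pow (ι n) n
    0<pow-ι : ∀ n → 0ℚ < pow (ι n) n
    0<pow-ι zero = positive⁻¹ 1ℚ
    0<pow-ι (suc n) = 0<pow (suc n) (0<ι {suc n} (ℕ.s≤s ℕ.z≤n))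

  sum≤length⇒prod≤1 : ∀ {xs} → All (0ℚ ≤_) xs → sumℚ xs ≤ ι (length xs) → prodℚ xs ≤ 1ℚ
  sum≤length⇒prod≤1 [] _ = ≤-refl
  sum≤length⇒prod≤1 {x ∷ xs} 0≤xs sum≤n = *-cancelʳ {J} (0<pow n (0<ι {n} (ℕ.s≤s ℕ.z≤n)))
    (subst₂ _≤_ (*-comm J (prodℚ (x ∷ xs))) (sym (*-identityˡ J))
      (≤-trans (am-gm 0≤xs) (pow-mono n (0≤sumℚ 0≤xs) sum≤n)))
    where
    n = length (x ∷ xs)
    J = pow (ι n) n

  -- Lower bounds for products of factors 1 + u

  Small : ℚ → Set
  Small u = ∣ u ∣ + ∣ u ∣ ≤ 1ℚ

  0≤1+2u : ∀ u → Small u → 0ℚ ≤ 1ℚ + u + u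
  0≤1+2u u h = ≤-trans (0≤+ (p≤q⇒0≤q-p h) (0≤+ (p≤q⇒0≤q-p (-∣p∣≤p u)) (p≤q⇒0≤q-p (-∣p∣≤p u))))
    (≤-reflexive (solve 2 (λ u a → con 1ℚ :- (a :+ a) :+ ((u :- :- a) :+ (u :- :- a)) := con 1ℚ :+ u :+ u) refl u ∣ u ∣))

  0≤1+u : ∀ u → Small u → 0ℚ ≤ 1ℚ + u
  0≤1+u u h = *-cancelʳ {2ℚ} (positive⁻¹ 2ℚ) (≤-trans (≤-reflexive (*-zeroˡ 2ℚ))
    (≤-trans (0≤+ 0≤1 (0≤1+2u u h)) (≤-reflexive (solve 1 (λ u → con 1ℚ :+ (con 1ℚ :+ u :+ u) := (con 1ℚ :+ u) :* con 2ℚ) refl u))))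

  0≤prod-1+u : ∀ {us} → All Small us → 0ℚ ≤ prodℚ (map (1ℚ +_) us)
  0≤prod-1+u [] = 0≤1
  0≤prod-1+u {u ∷ _} (h ∷ hs) = 0≤* (0≤1+u u h) (0≤prod-1+u hs)

  -- A polynomial upper bound for 1 / (1 + u): the product with 1 + u is 1 + u² (1 + 2u), which is
  -- at least 1 because `Small u` means |u| ≤ 1/2. Its quadratic term is the source of the loss 2 Σ
  -- u² in all exponents below.
  reciprocal : ℚ → ℚ
  reciprocal u = 1ℚ - u + (u * u + u * u)

  -- The list of A copies of 2 followed by the numbers 1 - u + 2u² has average at most 1,
  -- and 1 - u + 2u² ≥ 1 / (1 + u).
  prod-1+u≥2^A : ∀ A {us} → All Small us →
    ι A ≤ sumℚ us - 2ℚ * sumℚ (map (λ u → u * u) us) → pow 2ℚ A ≤ prodℚ (map (1ℚ +_) us)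
  prod-1+u≥2^A A {us} small ιA≤ = begin
    pow 2ℚ A                                     ≡⟨ *-identityʳ _ ⟨
    pow 2ℚ A * 1ℚ                                ≤⟨ *-monoʳ (0≤pow A 0≤2) (prod-inverse small) ⟩
    pow 2ℚ A * (R * P)                           ≡⟨ *-assoc (pow 2ℚ A) R P ⟨
    pow 2ℚ A * R * P                             ≤⟨ *-monoˡ (0≤prod-1+u small) 2^A*R≤1 ⟩
    1ℚ * P                                       ≡⟨ *-identityˡ P ⟩
    P                                            ∎
    where
    open ≤-Reasoning
    R = prodℚ (map reciprocal us)
    P = prodℚ (map (1ℚ +_) us)
    0≤2 : 0ℚ ≤ 2ℚ
    0≤2 = 0≤ι 2
    0≤reciprocal : ∀ u → 0ℚ ≤ reciprocal u
    0≤reciprocal u = *-cancelʳ {2ℚ} (positive⁻¹ 2ℚ) (≤-trans (≤-reflexive (*-zeroˡ 2ℚ))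
      (≤-trans (0≤+ (0≤+ 0≤1 (0≤p*p (1ℚ - u))) (0≤+ (0≤p*p u) (0≤+ (0≤p*p u) (0≤p*p u)))) (≤-reflexive
        (solve 1 (λ u → con 1ℚ :+ (con 1ℚ :- u) :* (con 1ℚ :- u) :+ (u :* u :+ (u :* u :+ u :* u)) :=
          (con 1ℚ :- u :+ (u :* u :+ u :* u)) :* con 2ℚ) refl u))))
    prod-inverse : ∀ {us} → All Small us → 1ℚ ≤ prodℚ (map reciprocal us) * prodℚ (map (1ℚ +_) us)
    prod-inverse [] = ≤-refl
    prod-inverse {u ∷ us} (h ∷ hs) = begin
      1ℚ                              ≤⟨ *-mono 0≤1 0≤rest 1≤first (prod-inverse hs) ⟩
      reciprocal u * (1ℚ + u) * (prodℚ (map reciprocal us) * prodℚ (map (1ℚ +_) us))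
        ≡⟨ solve 4 (λ a b c d → a :* b :* (c :* d) := a :* c :* (b :* d)) refl (reciprocal u) (1ℚ + u) _ _ ⟩
      reciprocal u * prodℚ (map reciprocal us) * ((1ℚ + u) * prodℚ (map (1ℚ +_) us)) ∎
      where
      0≤rest = ≤-trans 0≤1 (prod-inverse hs)
      1≤first : 1ℚ ≤ reciprocal u * (1ℚ + u)
      1≤first = ≤-by (u * u * (1ℚ + u + u)) (0≤* (0≤p*p u) (0≤1+2u u h))
        (solve 1 (λ u → (con 1ℚ :- u :+ (u :* u :+ u :* u)) :* (con 1ℚ :+ u) := con 1ℚ :+ u :* u :* (con 1ℚ :+ u :+ u)) refl u)
    list : ℕ → List ℚ
    list A = replicate A 2ℚ ++ map reciprocal us
    0≤list : ∀ A → All (0ℚ ≤_) (list A)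
    0≤list zero = go us where
      go : ∀ us → All (0ℚ ≤_) (map reciprocal us)
      go [] = []
      go (u ∷ us) = 0≤reciprocal u ∷ go us
    0≤list (suc A) = 0≤2 ∷ 0≤list A
    prod-list : ∀ A → prodℚ (list A) ≡ pow 2ℚ A * R
    prod-list zero = sym (*-identityˡ R)
    prod-list (suc A) = trans (cong (2ℚ *_) (prod-list A)) (sym (*-assoc 2ℚ (pow 2ℚ A) R))
    sum-list : ∀ A → sumℚ (list A) + (sumℚ us - 2ℚ * sumℚ (map (λ u → u * u) us)) ≡ ι (length (list A)) + ι A
    sum-list zero = trans (go us) (sym (+-identityʳ _)) where
      go : ∀ us → sumℚ (map reciprocal us) + (sumℚ us - 2ℚ * sumℚ (map (λ u → u * u) us)) ≡ ι (length (map reciprocal us))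
      go [] = refl
      go (u ∷ us) = trans
        (solve 4 (λ u r s q → (con 1ℚ :- u :+ (u :* u :+ u :* u)) :+ r :+ (u :+ s :- con 2ℚ :* (u :* u :+ q)) :=
            con 1ℚ :+ (r :+ (s :- con 2ℚ :* q))) refl u _ (sumℚ us) _)
        (cong (1ℚ +_) (go us))
    sum-list (suc A) = trans (+-assoc 2ℚ (sumℚ (list A)) _) (trans (cong (2ℚ +_) (sum-list A))
      (solve 2 (λ l a → con 2ℚ :+ (l :+ a) := con 1ℚ :+ l :+ (con 1ℚ :+ a)) refl (ι (length (list A))) (ι A)))
    2^A*R≤1 : pow 2ℚ A * R ≤ 1ℚ
    2^A*R≤1 = subst (_≤ 1ℚ) (prod-list A) (sum≤length⇒prod≤1 (0≤list A) (≤-by _ (p≤q⇒0≤q-p ιA≤)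
      (trans (solve 2 (λ l a → l := l :+ a :- a) refl _ (ι A)) (trans (cong (_- ι A) (sym (sum-list A)))
       (solve 3 (λ s d a → s :+ d :- a := s :+ (d :- a)) refl (sumℚ (list A)) _ (ι A))))))

  -- Martingale transforms on the biased cube

  module Bernoulli (t : ℚ) (0≤t : 0ℚ ≤ t) (t≤1 : t ≤ 1ℚ) where

    0≤1-t : 0ℚ ≤ 1ℚ - t
    0≤1-t = p≤q⇒0≤q-p t≤1

    f : Bool → ℚ
    f true = 1ℚ - t
    f false = - t

    ∣f∣≤1 : ∀ b → ∣ f b ∣ ≤ 1ℚ
    ∣f∣≤1 true = ≤-trans (≤-reflexive (0≤p⇒∣p∣≡p 0≤1-t))
      (≤-by t 0≤t (solve 1 (λ t → con 1ℚ := con 1ℚ :- t :+ t) refl t))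
    ∣f∣≤1 false = ≤-trans (≤-reflexive (trans (∣-p∣≡∣p∣ t) (0≤p⇒∣p∣≡p 0≤t))) t≤1

    avg : ∀ {n} → (Vec Bool (suc n) → ℚ) → Vec Bool n → ℚ
    avg Φ s = t * Φ (true ∷ s) + (1ℚ - t) * Φ (false ∷ s)

    diff : ∀ {n} → (Vec Bool (suc n) → ℚ) → Vec Bool n → ℚ
    diff Φ s = Φ (true ∷ s) - Φ (false ∷ s)

    -- The head is averaged out before the tail, so the past of a coordinate consists of the
    -- coordinates behind it: the filtration reveals a vector from its last entry to its first.
    𝔼 : ∀ {n} → (Vec Bool n → ℚ) → ℚ
    𝔼 {zero} Φ = Φ []
    𝔼 {suc n} Φ = 𝔼 (avg Φ)

    𝔼-cong : ∀ {n} {Φ Ψ : Vec Bool n → ℚ} → (∀ s → Φ s ≡ Ψ s) → 𝔼 Φ ≡ 𝔼 Ψ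
    𝔼-cong {zero} eq = eq []
    𝔼-cong {suc n} eq = 𝔼-cong λ s →
      cong₂ (λ p q → t * p + (1ℚ - t) * q) (eq (true ∷ s)) (eq (false ∷ s))

    𝔼-+ : ∀ {n} (Φ Ψ : Vec Bool n → ℚ) → 𝔼 (λ s → Φ s + Ψ s) ≡ 𝔼 Φ + 𝔼 Ψ
    𝔼-+ {zero} Φ Ψ = refl
    𝔼-+ {suc n} Φ Ψ = trans
      (𝔼-cong λ s → solve 5 (λ t a b c d → t :* (a :+ b) :+ (con 1ℚ :- t) :* (c :+ d) :=
          t :* a :+ (con 1ℚ :- t) :* c :+ (t :* b :+ (con 1ℚ :- t) :* d))
        refl t (Φ (true ∷ s)) (Ψ (true ∷ s)) (Φ (false ∷ s)) (Ψ (false ∷ s)))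
      (𝔼-+ (avg Φ) (avg Ψ))

    -- A predictable process: the entry attached to a coordinate is a function of the later coordinates.
    data Process : ℕ → Set where
      ∅   : Process 0
      _◂_ : ∀ {n} → (Vec Bool n → ℚ) → Process n → Process (suc n)

    infixr 5 _◂_

    -- The increments of the martingale transform of a process.
    path : ∀ {n} → Process n → Vec Bool n → List ℚ
    path ∅ [] = []
    path (G ◂ Gs) (b ∷ s) = f b * G s ∷ path Gs s

    I : ∀ {n} → Process n → Vec Bool n → ℚ
    I Gs s = sumℚ (path Gs s)

    Z : ∀ {n} → Process n → Vec Bool n → ℚ
    Z Gs s = prodℚ (map (1ℚ +_) (path Gs s))

    -- For a fixed tail the integrand is a constant and `f` has mean zero, so the head factor
    -- averages to 1 and drops out.
    𝔼-Z : ∀ {n} (Gs : Process n) → 𝔼 (Z Gs) ≡ 1ℚ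
    𝔼-Z ∅ = refl
    𝔼-Z (G ◂ Gs) = trans
      (𝔼-cong λ s → solve 3 (λ t g z → t :* ((con 1ℚ :+ (con 1ℚ :- t) :* g) :* z) :+
          (con 1ℚ :- t) :* ((con 1ℚ :+ :- t :* g) :* z) := z) refl t (G s) (Z Gs s))
      (𝔼-Z Gs)

    -- The integrands of the martingale representation: at each coordinate, the discrete derivative
    -- after all earlier entries of the vector have been averaged out.
    grad : ∀ {n} → (Vec Bool n → ℚ) → Process n
    grad {zero} Φ = ∅
    grad {suc n} Φ = diff Φ ◂ grad (avg Φ)

    -- Every function on a two-point space is affine in `f`: its value is the average plus `f` times
    -- the difference. Iterating over the coordinates gives the decomposition.
    doob : ∀ {n} (Φ : Vec Bool n → ℚ) s → Φ s ≡ 𝔼 Φ + I (grad Φ) s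
    doob {zero} Φ [] = sym (+-identityʳ (Φ []))
    doob {suc n} Φ (b ∷ s) = trans (one-step b) (trans (cong (_+ f b * diff Φ s) (doob (avg Φ) s))
      (solve 3 (λ e i x → e :+ i :+ x := e :+ (x :+ i)) refl (𝔼 (avg Φ)) (I (grad (avg Φ)) s) (f b * diff Φ s)))
      where
      one-step : ∀ b → Φ (b ∷ s) ≡ avg Φ s + f b * diff Φ s
      one-step true = solve 3 (λ t p q → p := t :* p :+ (con 1ℚ :- t) :* q :+ (con 1ℚ :- t) :* (p :- q))
        refl t (Φ (true ∷ s)) (Φ (false ∷ s))
      one-step false = solve 3 (λ t p q → q := t :* p :+ (con 1ℚ :- t) :* q :+ :- t :* (p :- q))
        refl t (Φ (true ∷ s)) (Φ (false ∷ s))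

    mapᵖ : ∀ {n} → (ℚ → ℚ) → Process n → Process n
    mapᵖ h ∅ = ∅
    mapᵖ h (G ◂ Gs) = (λ s → h (G s)) ◂ mapᵖ h Gs

    data Each (P : ∀ {n} → (Vec Bool n → ℚ) → Set) : ∀ {n} → Process n → Set where
      ∅   : Each P ∅
      _◂_ : ∀ {n} {G : Vec Bool n → ℚ} {Gs : Process n} → P G → Each P Gs → Each P (G ◂ Gs)

    -- In contrast to `Each`, a condition on the values met by one particular `s`. The bound on the
    -- centred first-order integrands holds only for typical `s`, so it can only be expressed in
    -- this way.
    data Along (P : ℚ → Set) : ∀ {n} → Process n → Vec Bool n → Set where
      ∅   : Along P ∅ []
      _◂_ : ∀ {n b} {s : Vec Bool n} {G : Vec Bool n → ℚ} {Gs : Process n} →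
            P (G s) → Along P Gs s → Along P (G ◂ Gs) (b ∷ s)

    Bounded : ℚ → ∀ {n} → (Vec Bool n → ℚ) → Set
    Bounded b G = ∀ s → ∣ G s ∣ ≤ b

    each⇒along : ∀ {b n} {Gs : Process n} → Each (Bounded b) Gs → ∀ s → Along (λ g → ∣ g ∣ ≤ b) Gs s
    each⇒along ∅ [] = ∅
    each⇒along (p ◂ ps) (_ ∷ s) = p s ◂ each⇒along ps s

    mapᵖ-bounded : ∀ {b h n} (Gs : Process n) → (∀ g → ∣ h g ∣ ≤ b) → Each (Bounded b) (mapᵖ h Gs)
    mapᵖ-bounded ∅ _ = ∅
    mapᵖ-bounded (G ◂ Gs) hb = (λ s → hb (G s)) ◂ mapᵖ-bounded Gs hb

    along-mapᵖ : ∀ {P Q : ℚ → Set} {h n} {Gs : Process n} {s} → (∀ g → P g → Q (h g)) →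
      Along P Gs s → Along Q (mapᵖ h Gs) s
    along-mapᵖ imp ∅ = ∅
    along-mapᵖ imp (p ◂ ps) = imp _ p ◂ along-mapᵖ imp ps

    path-small : ∀ {b n} {Gs : Process n} {s} → b + b ≤ 1ℚ → Along (λ g → ∣ g ∣ ≤ b) Gs s → All Small (path Gs s)
    path-small 2b≤1 ∅ = []
    path-small {b} 2b≤1 (_◂_ {b = x} {s = s} {G = G} p ps) = ≤-trans (+-mono-≤ ∣u∣≤b ∣u∣≤b) 2b≤1 ∷ path-small 2b≤1 ps
      where
      ∣u∣≤b : ∣ f x * G s ∣ ≤ b
      ∣u∣≤b = ≤-trans (≤-reflexive (∣p*q∣≡∣p∣*∣q∣ (f x) (G s)))
        (≤-trans (*-mono (0≤∣p∣ (f x)) (≤-trans (0≤∣p∣ (G s)) p) (∣f∣≤1 x) p) (≤-reflexive (*-identityˡ b)))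

    0≤Z : ∀ {b n} {Gs : Process n} {s} → b + b ≤ 1ℚ → Along (λ g → ∣ g ∣ ≤ b) Gs s → 0ℚ ≤ Z Gs s
    0≤Z 2b≤1 along = 0≤prod-1+u (path-small 2b≤1 along)

    ∑ : ∀ {n} → (Bool → ℚ) → Vec Bool n → ℚ
    ∑ h [] = 0ℚ
    ∑ h (b ∷ s) = h b + ∑ h s

    f² : Bool → ℚ
    f² b = f b * f b

    ∣f∣ : Bool → ℚ
    ∣f∣ b = ∣ f b ∣

    -- The squares are charged to Σ f², which is at most m on m-sets; estimating each |f| by 1 would
    -- produce the number of coordinates instead.
    path-squares : ∀ {b n} {Gs : Process n} {s} → Along (λ g → ∣ g ∣ ≤ b) Gs s →
      sumℚ (map (λ u → u * u) (path Gs s)) ≤ b * b * ∑ f² s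
    path-squares {b} ∅ = ≤-reflexive (sym (*-zeroʳ (b * b)))
    path-squares {b} (_◂_ {b = x} {s = s} {G = G} {Gs = Gs} p ps) = begin
      f x * G s * (f x * G s) + Q       ≡⟨ cong (_+ Q) (solve 2 (λ f g → f :* g :* (f :* g) := g :* g :* (f :* f)) refl (f x) (G s)) ⟩
      G s * G s * f² x + Q              ≤⟨ +-mono-≤ (*-monoˡ {f² x} (0≤p*p (f x)) (p*p≤b*b {G s} p)) (path-squares ps) ⟩
      b * b * f² x + b * b * ∑ f² s     ≡⟨ *-distribˡ-+ (b * b) (f² x) (∑ f² s) ⟨
      b * b * (f² x + ∑ f² s)           ∎
      where
      open ≤-Reasoning
      Q = sumℚ (map (λ u → u * u) (path Gs s))

    ∣I∣≤ : ∀ {b n} {Gs : Process n} {s} → Along (λ g → ∣ g ∣ ≤ b) Gs s → ∣ I Gs s ∣ ≤ b * ∑ ∣f∣ s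
    ∣I∣≤ {b} ∅ = ≤-reflexive (sym (*-zeroʳ b))
    ∣I∣≤ {b} (_◂_ {b = x} {s = s} {G = G} {Gs = Gs} p ps) = begin
      ∣ f x * G s + I Gs s ∣            ≤⟨ ∣p+q∣≤∣p∣+∣q∣ (f x * G s) (I Gs s) ⟩
      ∣ f x * G s ∣ + ∣ I Gs s ∣        ≡⟨ cong (_+ ∣ I Gs s ∣) (trans (∣p*q∣≡∣p∣*∣q∣ (f x) (G s)) (*-comm ∣ f x ∣ ∣ G s ∣)) ⟩
      ∣ G s ∣ * ∣ f x ∣ + ∣ I Gs s ∣    ≤⟨ +-mono-≤ (*-monoˡ (0≤∣p∣ (f x)) p) (∣I∣≤ ps) ⟩
      b * ∣ f x ∣ + b * ∑ ∣f∣ s         ≡⟨ *-distribˡ-+ b ∣ f x ∣ (∑ ∣f∣ s) ⟨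
      b * (∣ f x ∣ + ∑ ∣f∣ s)           ∎
      where open ≤-Reasoning

    scale : ∀ {n} → ℚ → Process n → Process n
    scale c = mapᵖ (c *_)

    I-scale : ∀ {n} c (Gs : Process n) s → I (scale c Gs) s ≡ c * I Gs s
    I-scale c ∅ [] = sym (*-zeroʳ c)
    I-scale c (G ◂ Gs) (b ∷ s) = trans (cong (f b * (c * G s) +_) (I-scale c Gs s))
      (solve 4 (λ f c g i → f :* (c :* g) :+ c :* i := c :* (f :* g :+ i)) refl (f b) c (G s) (I Gs s))

    I-shift : ∀ {n} ρ (Gs : Process n) s → I (mapᵖ (_- ρ) Gs) s ≡ I Gs s - ρ * ∑ f s
    I-shift ρ ∅ [] = solve 1 (λ r → con 0ℚ := con 0ℚ :- r :* con 0ℚ) refl ρ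
    I-shift ρ (G ◂ Gs) (b ∷ s) = trans (cong (f b * (G s - ρ) +_) (I-shift ρ Gs s))
      (solve 5 (λ f g r i s → f :* (g :- r) :+ (i :- r :* s) := f :* g :+ i :- r :* (f :+ s)) refl (f b) (G s) ρ (I Gs s) (∑ f s))

    -- Both signs of the exponent are added, in the manner of a hyperbolic cosine, so that one
    -- nonnegative function detects deviations in either direction.
    Z± : ∀ {n} → ℚ → Process n → Vec Bool n → ℚ
    Z± c Gs s = Z (scale c Gs) s + Z (scale (- c) Gs) s

    ∣c*g∣≤c*b : ∀ {c b} → 0ℚ ≤ c → ∀ g → ∣ g ∣ ≤ b → ∣ c * g ∣ ≤ c * b
    ∣c*g∣≤c*b {c} 0≤c g ∣g∣≤b = ≤-trans (≤-reflexive (trans (∣p*q∣≡∣p∣*∣q∣ c g) (cong (_* ∣ g ∣) (0≤p⇒∣p∣≡p 0≤c))))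
      (*-monoʳ 0≤c ∣g∣≤b)

    ∣-c*g∣≤c*b : ∀ {c b} → 0ℚ ≤ c → ∀ g → ∣ g ∣ ≤ b → ∣ - c * g ∣ ≤ c * b
    ∣-c*g∣≤c*b {c} {b} 0≤c g ∣g∣≤b = subst (_≤ c * b)
      (trans (sym (∣-p∣≡∣p∣ (c * g))) (cong ∣_∣ (neg-distribˡ-* c g))) (∣c*g∣≤c*b 0≤c g ∣g∣≤b)

    0≤Z± : ∀ {c b n} {Gs : Process n} {s} → 0ℚ ≤ c → c * b + c * b ≤ 1ℚ →
      Along (λ g → ∣ g ∣ ≤ b) Gs s → 0ℚ ≤ Z± c Gs s
    0≤Z± 0≤c 2cb≤1 along = 0≤+ (0≤Z 2cb≤1 (along-mapᵖ (∣c*g∣≤c*b 0≤c) along)) (0≤Z 2cb≤1 (along-mapᵖ (∣-c*g∣≤c*b 0≤c) along))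

    -- With the sign for which the scaled transform equals c |I|, the product is at least 2^A by
    -- `prod-1+u≥2^A`; the product for the other sign is nonnegative.
    Z±-large : ∀ A {c b v x n} {Gs : Process n} {s} → 0ℚ ≤ c → c * b + c * b ≤ 1ℚ →
      Along (λ g → ∣ g ∣ ≤ b) Gs s → ∑ f² s ≤ v → x ≤ ∣ I Gs s ∣ →
      ι A ≤ c * x - 2ℚ * (c * b * (c * b) * v) → pow 2ℚ A ≤ Z± c Gs s
    Z±-large A {c} {b} {v} {x} {Gs = Gs} {s} 0≤c 2cb≤1 along V≤v x≤∣I∣ ιA≤ = by-sign (∣p∣≡p∨∣p∣≡-p (I Gs s))
      where
      along⁺ = along-mapᵖ (∣c*g∣≤c*b 0≤c) along
      along⁻ = along-mapᵖ (∣-c*g∣≤c*b 0≤c) along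
      one-sided : ∀ d → Along (λ g → ∣ g ∣ ≤ c * b) (scale d Gs) s → d * I Gs s ≡ c * ∣ I Gs s ∣ → pow 2ℚ A ≤ Z (scale d Gs) s
      one-sided d al eq = prod-1+u≥2^A A (path-small 2cb≤1 al) (≤-trans ιA≤ (+-mono-≤
        (≤-trans (*-monoʳ 0≤c x≤∣I∣) (≤-reflexive (trans (sym eq) (sym (I-scale d Gs s)))))
        (neg-antimono-≤ (*-monoʳ {2ℚ} (0≤ι 2) (≤-trans (path-squares al) (*-monoʳ (0≤p*p (c * b)) V≤v))))))
      by-sign : ∣ I Gs s ∣ ≡ I Gs s ⊎ ∣ I Gs s ∣ ≡ - I Gs s → pow 2ℚ A ≤ Z± c Gs s
      by-sign (inj₁ eq) = ≤-trans (one-sided c along⁺ (cong (c *_) (sym eq)))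
        (≤-by _ (0≤Z 2cb≤1 along⁻) refl)
      by-sign (inj₂ eq) = ≤-trans
        (one-sided (- c) along⁻ (trans (solve 2 (λ c i → :- c :* i := c :* :- i) refl c (I Gs s)) (cong (c *_) (sym eq))))
        (≤-by _ (0≤Z 2cb≤1 along⁺) (+-comm (Z (scale c Gs) s) (Z (scale (- c) Gs) s)))

    𝔼-Z± : ∀ {n} c (Gs : Process n) → 𝔼 (Z± c Gs) ≡ 2ℚ
    𝔼-Z± c Gs = trans (𝔼-+ (Z (scale c Gs)) (Z (scale (- c) Gs))) (cong₂ _+_ (𝔼-Z (scale c Gs)) (𝔼-Z (scale (- c) Gs)))

    -- A union bound over the coordinates in the form of one function: each integrand of the process
    -- contributes the detector of its own deviations, with expectation 2.
    U : ∀ {n} → ℚ → Process n → Vec Bool n → ℚ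
    U μ ∅ [] = 0ℚ
    U μ (G ◂ Gs) (b ∷ s) = Z± μ (grad G) s + U μ Gs s

    𝔼-U : ∀ {n} μ (Gs : Process n) → 𝔼 (U μ Gs) ≡ ι n * 2ℚ
    𝔼-U μ ∅ = sym (*-zeroˡ 2ℚ)
    𝔼-U {suc n} μ (G ◂ Gs) = trans
      (𝔼-cong λ s → solve 2 (λ t x → t :* x :+ (con 1ℚ :- t) :* x := x) refl t (Z± μ (grad G) s + U μ Gs s))
      (trans (𝔼-+ (Z± μ (grad G)) (U μ Gs)) (trans (cong₂ _+_ (𝔼-Z± μ (grad G)) (𝔼-U μ Gs))
        (solve 1 (λ n → con 2ℚ :+ n :* con 2ℚ := (con 1ℚ :+ n) :* con 2ℚ) refl (ι n))))

    0≤U : ∀ {μ κ n} {Gs : Process n} → 0ℚ ≤ μ → μ * κ + μ * κ ≤ 1ℚ →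
      Each (λ G → Each (Bounded κ) (grad G)) Gs → ∀ s → 0ℚ ≤ U μ Gs s
    0≤U 0≤μ small ∅ [] = ≤-refl
    0≤U 0≤μ small (bd ◂ bds) (_ ∷ s) = 0≤+ (0≤Z± 0≤μ small (each⇒along bd s)) (0≤U 0≤μ small bds s)

    ∑-tail : ∀ {n h} b (s : Vec Bool n) → (∀ b → 0ℚ ≤ h b) → ∑ h s ≤ ∑ h (b ∷ s)
    ∑-tail {h = h} b s 0≤h = ≤-by (h b) (0≤h b) (+-comm (h b) (∑ h s))

    0≤f² : ∀ b → 0ℚ ≤ f² b
    0≤f² b = 0≤p*p (f b)

    0≤∣f∣ : ∀ b → 0ℚ ≤ ∣f∣ b
    0≤∣f∣ b = 0≤∣p∣ (f b)

    -- Centred integrands and the combined two-level detector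

    module _ {ρ κ : ℚ} where

      HasMean : ∀ {n} → (Vec Bool n → ℚ) → Set
      HasMean G = 𝔼 G ≡ ρ

      Smooth : ∀ {n} → (Vec Bool n → ℚ) → Set
      Smooth G = Each (Bounded κ) (grad G)

      centred : ∀ {n} (G : Vec Bool n → ℚ) → HasMean G → ∀ s → G s - ρ ≡ I (grad G) s
      centred G refl s = trans (cong (_- 𝔼 G) (doob G s))
        (solve 2 (λ e i → e :+ i :- e := i) refl (𝔼 G) (I (grad G) s))

      along-centred : ∀ {n w} {Gs : Process n} {s} → 0ℚ ≤ κ → Each HasMean Gs → Each Smooth Gs → ∑ ∣f∣ s ≤ w →
        Along (λ g → ∣ g ∣ ≤ κ * w) (mapᵖ (_- ρ) Gs) s
      along-centred {s = []} 0≤κ ∅ ∅ _ = ∅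
      along-centred {Gs = G ◂ Gs} {s = b ∷ s} 0≤κ (mean ◂ means) (sm ◂ sms) W≤w =
        ≤-trans (≤-reflexive (cong ∣_∣ (centred G mean s))) (≤-trans (∣I∣≤ (each⇒along sm s)) (*-monoʳ 0≤κ W≤w′))
        ◂ along-centred 0≤κ means sms W≤w′
        where W≤w′ = ≤-trans (∑-tail b s 0≤∣f∣) W≤w

      -- An integrand that violates the bound makes its own summand of `U` at least 2^A, and the
      -- other summands are nonnegative. The Σ f² over the past of a coordinate is only part of the
      -- full one, so a single `v` serves everywhere.
      along-or-U-large : ∀ A {S μ v n} {Gs : Process n} {s} → 0ℚ ≤ μ → μ * κ + μ * κ ≤ 1ℚ →
        ι A ≤ μ * S - 2ℚ * (μ * κ * (μ * κ) * v) →
        Each HasMean Gs → Each Smooth Gs → ∑ f² s ≤ v →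
        Along (λ g → ∣ g - ρ ∣ ≤ S) Gs s ⊎ pow 2ℚ A ≤ U μ Gs s
      along-or-U-large A {s = []} _ _ _ ∅ ∅ _ = inj₁ ∅
      along-or-U-large A {S} {μ} {Gs = G ◂ Gs} {s = b ∷ s} 0≤μ small ιA≤ (mean ◂ means) (sm ◂ sms) V≤v
        with ∣ G s - ρ ∣ ≤? S
      ... | no ≰S = inj₂ (≤-trans
              (Z±-large A 0≤μ small (each⇒along sm s) V≤v′ (subst (S ≤_) (cong ∣_∣ (centred G mean s)) (<⇒≤ (≰⇒> ≰S))) ιA≤)
              (≤-by (U μ Gs s) (0≤U 0≤μ small sms s) refl))
        where V≤v′ = ≤-trans (∑-tail b s 0≤f²) V≤v
      ... | yes ≤S with along-or-U-large A 0≤μ small ιA≤ means sms (≤-trans (∑-tail b s 0≤f²) V≤v)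
      ...   | inj₁ al = inj₁ (≤S ◂ al)
      ...   | inj₂ large = inj₂ (≤-trans large (≤-by (Z± μ (grad G) s) (0≤Z± 0≤μ small (each⇒along sm s)) (+-comm (Z± μ (grad G) s) (U μ Gs s))))

      -- Clipping keeps the factors of Z± positive for all s, also where ∣ g - ρ ∣ exceeds S.
      clip : ℚ → ℚ → ℚ
      clip S g with ∣ g - ρ ∣ ≤? S
      ... | yes _ = g - ρ
      ... | no _ = 0ℚ

      ∣clip∣≤ : ∀ {S} → 0ℚ ≤ S → ∀ g → ∣ clip S g ∣ ≤ S
      ∣clip∣≤ {S} 0≤S g with ∣ g - ρ ∣ ≤? S
      ... | yes ≤S = ≤S
      ... | no _ = 0≤S

      clip-inactive : ∀ {S g} → ∣ g - ρ ∣ ≤ S → clip S g ≡ g - ρ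
      clip-inactive {S} {g} ≤S with ∣ g - ρ ∣ ≤? S
      ... | yes _ = refl
      ... | no ≰S = ⊥-elim (≰S ≤S)

      I-clip : ∀ {S n} {Gs : Process n} {s} → Along (λ g → ∣ g - ρ ∣ ≤ S) Gs s →
        I (mapᵖ (clip S) Gs) s ≡ I (mapᵖ (_- ρ) Gs) s
      I-clip ∅ = refl
      I-clip {S} (_◂_ {b = b} {s = s} {G = G} ≤S al) = cong₂ _+_ (cong (f b *_) (clip-inactive {S} {G s} ≤S)) (I-clip al)

      centred-I : ∀ {n} (Φ : Vec Bool n → ℚ) s → ∑ f s ≡ 0ℚ → Φ s - 𝔼 Φ ≡ I (mapᵖ (_- ρ) (grad Φ)) s
      centred-I Φ s Σf≡0 = trans (cong (_- 𝔼 Φ) (doob Φ s))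
        (trans (solve 3 (λ e i r → e :+ i :- e := i :- r :* con 0ℚ) refl (𝔼 Φ) (I (grad Φ) s) ρ)
        (trans (cong (λ z → I (grad Φ) s - ρ * z) (sym Σf≡0)) (sym (I-shift ρ (grad Φ) s))))

      -- The detectors of both levels are added, so that one application of Markov's inequality
      -- covers large integrands as well as a large deviation with small integrands.
      W : ∀ {n} → ℚ → ℚ → ℚ → (Vec Bool n → ℚ) → Vec Bool n → ℚ
      W c S μ Φ s = Z± c (mapᵖ (clip S) (grad Φ)) s + U μ (grad Φ) s

      𝔼-W : ∀ {n} c S μ (Φ : Vec Bool n → ℚ) → 𝔼 (W c S μ Φ) ≡ ι (suc n) * 2ℚ
      𝔼-W {n} c S μ Φ = trans (𝔼-+ (Z± c (mapᵖ (clip S) (grad Φ))) (U μ (grad Φ)))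
        (trans (cong₂ _+_ (𝔼-Z± c (mapᵖ (clip S) (grad Φ))) (𝔼-U μ (grad Φ)))
        (solve 1 (λ n → con 2ℚ :+ n :* con 2ℚ := (con 1ℚ :+ n) :* con 2ℚ) refl (ι n)))

      module _ {c S μ : ℚ} (0≤c : 0ℚ ≤ c) (0≤S : 0ℚ ≤ S) (0≤μ : 0ℚ ≤ μ)
               (cS-small : c * S + c * S ≤ 1ℚ) (μκ-small : μ * κ + μ * κ ≤ 1ℚ)
               {n} {Φ : Vec Bool n → ℚ} (means : Each HasMean (grad Φ)) (smooth : Each Smooth (grad Φ)) where

        0≤Z±clip : ∀ s → 0ℚ ≤ Z± c (mapᵖ (clip S) (grad Φ)) s
        0≤Z±clip s = 0≤Z± 0≤c cS-small (each⇒along (mapᵖ-bounded (grad Φ) (∣clip∣≤ 0≤S)) s)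

        0≤W : ∀ s → 0ℚ ≤ W c S μ Φ s
        0≤W s = 0≤+ (0≤Z±clip s) (0≤U 0≤μ μκ-small smooth s)

        W-large : ∀ A {x v s} → ι A ≤ c * x - 2ℚ * (c * S * (c * S) * v) → ι A ≤ μ * S - 2ℚ * (μ * κ * (μ * κ) * v) →
          ∑ f s ≡ 0ℚ → ∑ f² s ≤ v → x ≤ ∣ Φ s - 𝔼 Φ ∣ → pow 2ℚ A ≤ W c S μ Φ s
        W-large A {x} {s = s} h₁ h₂ Σf≡0 V≤v x≤ with along-or-U-large A 0≤μ μκ-small h₂ means smooth V≤v
        ... | inj₂ large = ≤-trans large (≤-by _ (0≤Z±clip s) (+-comm (Z± c (mapᵖ (clip S) (grad Φ)) s) (U μ (grad Φ) s)))
        ... | inj₁ al = ≤-trans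
          (Z±-large A 0≤c cS-small (each⇒along (mapᵖ-bounded (grad Φ) (∣clip∣≤ 0≤S)) s) V≤v
            (subst (x ≤_) (cong ∣_∣ (trans (centred-I Φ s Σf≡0) (sym (I-clip al)))) x≤) h₁)
          (≤-by (U μ (grad Φ) s) (0≤U 0≤μ μκ-small smooth s) refl)

      -- The worst case: the bound Σ |f| ≤ w applied on both levels. It settles the range A > m and
      -- caps the contribution of exceptional sets to the mean.
      deviation-bound : ∀ {n w} {Φ : Vec Bool n → ℚ} → 0ℚ ≤ κ → Each HasMean (grad Φ) → Each Smooth (grad Φ) →
        ∀ s → ∑ f s ≡ 0ℚ → ∑ ∣f∣ s ≤ w → ∣ Φ s - 𝔼 Φ ∣ ≤ κ * w * w
      deviation-bound {w = w} {Φ} 0≤κ means smooth s Σf≡0 W≤w = ≤-trans (≤-reflexive (cong ∣_∣ (centred-I Φ s Σf≡0)))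
        (≤-trans (∣I∣≤ (along-centred 0≤κ means smooth W≤w)) (*-monoʳ (0≤* 0≤κ 0≤w) W≤w))
        where
        0≤∑ : ∀ {n} (s : Vec Bool n) → 0ℚ ≤ ∑ ∣f∣ s
        0≤∑ [] = ≤-refl
        0≤∑ (b ∷ s) = 0≤+ (0≤∣f∣ b) (0≤∑ s)
        0≤w = ≤-trans (0≤∑ s) W≤w

  -- Finite sums and monomials

  Sum : ∀ {X : Set} → List X → (X → ℚ) → ℚ
  Sum [] h = 0ℚ
  Sum (x ∷ xs) h = h x + Sum xs h

  Sum-cong : ∀ {X : Set} (xs : List X) {h g} → (∀ x → h x ≡ g x) → Sum xs h ≡ Sum xs g
  Sum-cong [] eq = refl
  Sum-cong (x ∷ xs) eq = cong₂ _+_ (eq x) (Sum-cong xs eq)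

  Sum-mono : ∀ {X : Set} (xs : List X) {h g} → (∀ x → h x ≤ g x) → Sum xs h ≤ Sum xs g
  Sum-mono [] le = ≤-refl
  Sum-mono (x ∷ xs) le = +-mono-≤ (le x) (Sum-mono xs le)

  0≤Sum : ∀ {X : Set} (xs : List X) {h} → (∀ x → 0ℚ ≤ h x) → 0ℚ ≤ Sum xs h
  0≤Sum [] le = ≤-refl
  0≤Sum (x ∷ xs) le = 0≤+ (le x) (0≤Sum xs le)

  Sum-linear : ∀ {X : Set} (xs : List X) a b h g → Sum xs (λ x → a * h x + b * g x) ≡ a * Sum xs h + b * Sum xs g
  Sum-linear [] a b h g = solve 2 (λ a b → con 0ℚ := a :* con 0ℚ :+ b :* con 0ℚ) refl a b
  Sum-linear (x ∷ xs) a b h g = trans (cong (a * h x + b * g x +_) (Sum-linear xs a b h g))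
    (solve 6 (λ a b h g H G → a :* h :+ b :* g :+ (a :* H :+ b :* G) := a :* (h :+ H) :+ b :* (g :+ G))
      refl a b (h x) (g x) (Sum xs h) (Sum xs g))

  Sum-++ : ∀ {X : Set} (xs ys : List X) h → Sum (xs ++ ys) h ≡ Sum xs h + Sum ys h
  Sum-++ [] ys h = sym (+-identityˡ (Sum ys h))
  Sum-++ (x ∷ xs) ys h = trans (cong (h x +_) (Sum-++ xs ys h)) (sym (+-assoc (h x) (Sum xs h) (Sum ys h)))

  Sum-map : ∀ {X Y : Set} (φ : X → Y) (xs : List X) h → Sum (map φ xs) h ≡ Sum xs (λ x → h (φ x))
  Sum-map φ [] h = refl
  Sum-map φ (x ∷ xs) h = cong (h (φ x) +_) (Sum-map φ xs h)

  Sum-const : ∀ {X : Set} (xs : List X) c → Sum xs (λ _ → c) ≡ ι (length xs) * c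
  Sum-const [] c = sym (*-zeroˡ c)
  Sum-const (x ∷ xs) c = trans (cong (c +_) (Sum-const xs c))
    (solve 2 (λ n c → c :+ n :* c := (con 1ℚ :+ n) :* c) refl (ι (length xs)) c)

  ⟦_⟧ : Bool → ℚ
  ⟦ true ⟧ = 1ℚ
  ⟦ false ⟧ = 0ℚ

  0≤⟦⟧ : ∀ b → 0ℚ ≤ ⟦ b ⟧
  0≤⟦⟧ true = 0≤1
  0≤⟦⟧ false = ≤-refl

  δ : ℕ → ℕ → ℚ
  δ zero zero = 1ℚ
  δ zero (suc _) = 0ℚ
  δ (suc _) zero = 0ℚ
  δ (suc i) (suc j) = δ i j

  δ-refl : ∀ i → δ i i ≡ 1ℚ
  δ-refl zero = refl
  δ-refl (suc i) = δ-refl i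

  δ-≢ : ∀ i j → i ≢ j → δ i j ≡ 0ℚ
  δ-≢ zero zero i≢j = ⊥-elim (i≢j refl)
  δ-≢ zero (suc j) _ = refl
  δ-≢ (suc i) zero _ = refl
  δ-≢ (suc i) (suc j) i≢j = δ-≢ i j λ eq → i≢j (cong suc eq)

  factor : Bool → Bool → ℚ
  factor true b = ⟦ b ⟧
  factor false _ = 1ℚ

  0≤factor : ∀ p b → 0ℚ ≤ factor p b
  0≤factor true b = 0≤⟦⟧ b
  0≤factor false b = 0≤1

  factor≤1 : ∀ p b → factor p b ≤ 1ℚ
  factor≤1 true true = ≤-refl
  factor≤1 true false = 0≤1
  factor≤1 false b = ≤-refl

  -- mono P s = 1 if P ⊆ s, and 0 otherwise
  mono : ∀ {n} → Vec Bool n → Vec Bool n → ℚ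
  mono P [] = 1ℚ
  mono P (b ∷ s) = factor (head P) b * mono (tail P) s

  0≤mono : ∀ {n} (P s : Vec Bool n) → 0ℚ ≤ mono P s
  0≤mono P [] = 0≤1
  0≤mono P (b ∷ s) = 0≤* (0≤factor (head P) b) (0≤mono (tail P) s)

  mono≤1 : ∀ {n} (P s : Vec Bool n) → mono P s ≤ 1ℚ
  mono≤1 P [] = ≤-refl
  mono≤1 P (b ∷ s) = *-mono (0≤factor (head P) b) 0≤1 (factor≤1 (head P) b) (mono≤1 (tail P) s)

  at : ∀ {n} → Vec Bool n → Fin n → Bool
  at P zero = head P
  at P (suc x) = at (tail P) x

  -- Derivatives of the edge count of a hypergraph

  module Hypergraph (t : ℚ) (0≤t : 0ℚ ≤ t) (t≤1 : t ≤ 1ℚ) where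

    open Bernoulli t 0≤t t≤1

    prob : Bool → ℚ
    prob true = t
    prob false = 1ℚ

    0≤prob : ∀ b → 0ℚ ≤ prob b
    0≤prob true = 0≤t
    0≤prob false = 0≤1

    prob≤1 : ∀ b → prob b ≤ 1ℚ
    prob≤1 true = t≤1
    prob≤1 false = ≤-refl

    𝔼mono : ∀ {n} → Vec Bool n → ℚ
    𝔼mono {zero} P = 1ℚ
    𝔼mono {suc n} P = prob (head P) * 𝔼mono (tail P)

    -- the expectation of the discrete derivative of mono P in the direction x
    𝔼∂mono : ∀ {n} → Fin n → Vec Bool n → ℚ
    𝔼∂mono zero P = ⟦ head P ⟧ * 𝔼mono (tail P)
    𝔼∂mono (suc x) P = prob (head P) * 𝔼∂mono x (tail P)

    module _ {X : Set} (xs : List X) where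

      -- Combinations of monomials are closed under `avg` and `diff`: each edge loses its head, and
      -- its coefficient is multiplied by `prob` or by the incidence with the head. Bounds on the
      -- process thus become bounds on sums of coefficients.
      record Represents {n} (Ψ : Vec Bool n → ℚ) (c : X → ℚ) (P : X → Vec Bool n) : Set where
        constructor mk
        field
          expand : ∀ s → Ψ s ≡ Sum xs (λ i → c i * mono (P i) s)
      open Represents

      rep-avg : ∀ {n} {Ψ : Vec Bool (suc n) → ℚ} {c P} → Represents Ψ c P →
        Represents (avg Ψ) (λ i → c i * prob (head (P i))) (λ i → tail (P i))
      rep-avg {Ψ = Ψ} {c} {P} rep = mk λ s → trans (cong₂ (λ a b → t * a + (1ℚ - t) * b) (expand rep (true ∷ s)) (expand rep (false ∷ s)))
        (trans (sym (Sum-linear xs t (1ℚ - t) _ _)) (Sum-cong xs λ i → at-head (c i) (head (P i)) (mono (tail (P i)) s)))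
        where
        at-head : ∀ c p m → t * (c * (factor p true * m)) + (1ℚ - t) * (c * (factor p false * m)) ≡ c * prob p * m
        at-head c true m = solve 3 (λ t c m → t :* (c :* (con 1ℚ :* m)) :+ (con 1ℚ :- t) :* (c :* (con 0ℚ :* m)) := c :* t :* m) refl t c m
        at-head c false m = solve 3 (λ t c m → t :* (c :* (con 1ℚ :* m)) :+ (con 1ℚ :- t) :* (c :* (con 1ℚ :* m)) := c :* con 1ℚ :* m) refl t c m

      rep-diff : ∀ {n} {Ψ : Vec Bool (suc n) → ℚ} {c P} → Represents Ψ c P →
        Represents (diff Ψ) (λ i → c i * ⟦ head (P i) ⟧) (λ i → tail (P i))
      rep-diff {Ψ = Ψ} {c} {P} rep = mk λ s → trans (cong₂ _-_ (expand rep (true ∷ s)) (expand rep (false ∷ s)))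
        (trans (solve 2 (λ a b → a :- b := con 1ℚ :* a :+ :- con 1ℚ :* b) refl (Sum xs _) (Sum xs _))
        (trans (sym (Sum-linear xs 1ℚ (- 1ℚ) _ _)) (Sum-cong xs λ i → at-head (c i) (head (P i)) (mono (tail (P i)) s))))
        where
        at-head : ∀ c p m → 1ℚ * (c * (factor p true * m)) + - 1ℚ * (c * (factor p false * m)) ≡ c * ⟦ p ⟧ * m
        at-head c true m = solve 2 (λ c m → con 1ℚ :* (c :* (con 1ℚ :* m)) :+ :- con 1ℚ :* (c :* (con 0ℚ :* m)) := c :* con 1ℚ :* m) refl c m
        at-head c false m = solve 2 (λ c m → con 1ℚ :* (c :* (con 1ℚ :* m)) :+ :- con 1ℚ :* (c :* (con 1ℚ :* m)) := c :* con 0ℚ :* m) refl c m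

      𝔼-rep : ∀ {n} {Ψ : Vec Bool n → ℚ} {c P} → Represents Ψ c P → 𝔼 Ψ ≡ Sum xs (λ i → c i * 𝔼mono (P i))
      𝔼-rep {zero} rep = expand rep []
      𝔼-rep {suc n} {Ψ} {c} {P} rep = trans (𝔼-rep (rep-avg rep)) (Sum-cong xs λ i → *-assoc (c i) (prob (head (P i))) (𝔼mono (tail (P i))))

      -- Averaging out the entries before x does not change a mean, so the integrand at x has the
      -- mean of the full discrete derivative in direction x.
      means : ∀ {ρ n} {Ψ : Vec Bool n → ℚ} {c P} → Represents Ψ c P →
        (∀ x → Sum xs (λ i → c i * 𝔼∂mono x (P i)) ≡ ρ) → Each (λ G → 𝔼 G ≡ ρ) (grad Ψ)
      means {n = zero} rep eq = ∅
      means {n = suc n} {Ψ} {c} {P} rep eq =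
        trans (𝔼-rep (rep-diff rep)) (trans (Sum-cong xs λ i → *-assoc (c i) ⟦ head (P i) ⟧ (𝔼mono (tail (P i)))) (eq zero))
        ◂ means (rep-avg rep)
            (λ x → trans (Sum-cong xs λ i → *-assoc (c i) (prob (head (P i))) (𝔼∂mono x (tail (P i)))) (eq (suc x)))

      -- Monomials lie in [0, 1] and coefficients are nonnegative, so a derivative at y is at most
      -- the weighted degree of y. Averaging multiplies coefficients by t or 1 and cannot raise that
      -- degree.
      grad-bounded : ∀ {κ n} {Ψ : Vec Bool n → ℚ} {c P} → Represents Ψ c P → (∀ i → 0ℚ ≤ c i) →
        (∀ y → Sum xs (λ i → c i * ⟦ at (P i) y ⟧) ≤ κ) → Each (Bounded κ) (grad Ψ)
      grad-bounded {n = zero} rep 0≤c deg = ∅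
      grad-bounded {κ} {suc n} {Ψ} {c} {P} rep 0≤c deg = bounded ◂ grad-bounded (rep-avg rep)
          (λ i → 0≤* (0≤c i) (0≤prob (head (P i))))
          (λ y → ≤-trans (Sum-mono xs λ i → *-monoˡ (0≤⟦⟧ (at (tail (P i)) y)) (c*prob≤c i)) (deg (suc y)))
        where
        c*prob≤c : ∀ i → c i * prob (head (P i)) ≤ c i
        c*prob≤c i = ≤-trans (*-monoʳ (0≤c i) (prob≤1 (head (P i)))) (≤-reflexive (*-identityʳ (c i)))
        0≤c⟦⟧ : ∀ i → 0ℚ ≤ c i * ⟦ head (P i) ⟧
        0≤c⟦⟧ i = 0≤* (0≤c i) (0≤⟦⟧ (head (P i)))
        bounded : Bounded κ (diff Ψ)
        bounded s = begin
          ∣ diff Ψ s ∣                                                   ≡⟨ cong ∣_∣ (expand (rep-diff rep) s) ⟩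
          ∣ Sum xs (λ i → c i * ⟦ head (P i) ⟧ * mono (tail (P i)) s) ∣  ≡⟨ 0≤p⇒∣p∣≡p (0≤Sum xs λ i → 0≤* (0≤c⟦⟧ i) (0≤mono (tail (P i)) s)) ⟩
          Sum xs (λ i → c i * ⟦ head (P i) ⟧ * mono (tail (P i)) s)
            ≤⟨ Sum-mono xs (λ i → ≤-trans (*-monoʳ (0≤c⟦⟧ i) (mono≤1 (tail (P i)) s)) (≤-reflexive (*-identityʳ _))) ⟩
          Sum xs (λ i → c i * ⟦ head (P i) ⟧)                            ≤⟨ deg zero ⟩
          κ                                                              ∎
          where open ≤-Reasoning

      -- Differentiating at x keeps the edges through x, so the degree of y in what remains is the
      -- codegree of x and y.
      smooth : ∀ {κ n} {Ψ : Vec Bool n → ℚ} {c P} → Represents Ψ c P → (∀ i → 0ℚ ≤ c i) →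
        (∀ x y → x ≢ y → Sum xs (λ i → c i * ⟦ at (P i) x ⟧ * ⟦ at (P i) y ⟧) ≤ κ) →
        Each (λ G → Each (Bounded κ) (grad G)) (grad Ψ)
      smooth {n = zero} rep 0≤c codeg = ∅
      smooth {κ} {suc n} {Ψ} {c} {P} rep 0≤c codeg =
        grad-bounded (rep-diff rep) (λ i → 0≤* (0≤c i) (0≤⟦⟧ (head (P i)))) (λ y → codeg zero (suc y) λ ())
        ◂ smooth (rep-avg rep) (λ i → 0≤* (0≤c i) (0≤prob (head (P i))))
            (λ x y x≢y → ≤-trans (Sum-mono xs λ i → *-monoˡ (0≤⟦⟧ (at (tail (P i)) y)) (*-monoˡ (0≤⟦⟧ (at (tail (P i)) x)) (c*prob≤c i)))
              (codeg (suc x) (suc y) λ { refl → x≢y refl }))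
        where
        c*prob≤c : ∀ i → c i * prob (head (P i)) ≤ c i
        c*prob≤c i = ≤-trans (*-monoʳ (0≤c i) (prob≤1 (head (P i)))) (≤-reflexive (*-identityʳ (c i)))

    weight : ∀ {n} → Vec Bool n → ℚ
    weight [] = 1ℚ
    weight (true ∷ s) = t * weight s
    weight (false ∷ s) = (1ℚ - t) * weight s

    0≤weight : ∀ {n} (s : Vec Bool n) → 0ℚ ≤ weight s
    0≤weight [] = 0≤1
    0≤weight (true ∷ s) = 0≤* 0≤t (0≤weight s)
    0≤weight (false ∷ s) = 0≤* 0≤1-t (0≤weight s)

    𝔼-Sum : ∀ {n} (Φ : Vec Bool n → ℚ) → 𝔼 Φ ≡ Sum (allSubsets n) (λ s → weight s * Φ s)
    𝔼-Sum {zero} Φ = solve 1 (λ x → x := con 1ℚ :* x :+ con 0ℚ) refl (Φ [])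
    𝔼-Sum {suc n} Φ = trans (𝔼-Sum (avg Φ)) (trans
      (Sum-cong (allSubsets n) λ s → solve 4 (λ t w a b →
           w :* (t :* a :+ (con 1ℚ :- t) :* b) := con 1ℚ :* (t :* w :* a) :+ con 1ℚ :* ((con 1ℚ :- t) :* w :* b))
         refl t (weight s) (Φ (true ∷ s)) (Φ (false ∷ s)))
      (trans (Sum-linear (allSubsets n) 1ℚ 1ℚ (λ s → h (true ∷ s)) (λ s → h (false ∷ s)))
      (trans (cong₂ _+_ (*-identityˡ (Sum (allSubsets n) λ s → h (true ∷ s))) (*-identityˡ (Sum (allSubsets n) λ s → h (false ∷ s))))
      (sym (trans (Sum-++ (map (true ∷_) (allSubsets n)) (map (false ∷_) (allSubsets n)) h)
        (cong₂ _+_ (Sum-map (true ∷_) (allSubsets n) h) (Sum-map (false ∷_) (allSubsets n) h)))))))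
      where
      h : Vec Bool (suc n) → ℚ
      h s = weight s * Φ s

    wt : ℕ → ℕ → ℚ
    wt n j = pow t j * pow (1ℚ - t) (n ℕ.∸ j)

    weight≡wt : ∀ {n} (s : Vec Bool n) → weight s ≡ wt n (size s)
    weight≡wt [] = refl
    weight≡wt {suc n} (true ∷ s) = trans (cong (t *_) (weight≡wt s)) (sym (*-assoc t _ _))
    weight≡wt {suc n} (false ∷ s) = trans (cong ((1ℚ - t) *_) (weight≡wt s))
      (trans (solve 3 (λ q a b → q :* (a :* b) := a :* (q :* b)) refl (1ℚ - t) (pow t (size s)) (pow (1ℚ - t) (n ℕ.∸ size s)))
        (cong (λ k → pow t (size s) * pow (1ℚ - t) k) (sym (ℕ.+-∸-assoc 1 (∣p∣≤n s)))))

  -- The binomial distribution, its mode, and Markov's inequality on m-subsets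

  module Counting (t : ℚ) (0≤t : 0ℚ ≤ t) (t≤1 : t ≤ 1ℚ) where

    open Bernoulli t 0≤t t≤1
    open Hypergraph t 0≤t t≤1

    𝔼-* : ∀ {n} a (Φ : Vec Bool n → ℚ) → 𝔼 (λ s → a * Φ s) ≡ a * 𝔼 Φ
    𝔼-* {zero} a Φ = refl
    𝔼-* {suc n} a Φ = trans
      (𝔼-cong λ s → solve 4 (λ t a x y → t :* (a :* x) :+ (con 1ℚ :- t) :* (a :* y) := a :* (t :* x :+ (con 1ℚ :- t) :* y))
        refl t a (Φ (true ∷ s)) (Φ (false ∷ s)))
      (𝔼-* a (avg Φ))

    -- The binomial probability of size j, written as an expectation so that Pascal's recursion
    -- comes from the recursion of `𝔼`, with no binomial coefficients.
    B : ℕ → ℕ → ℚ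
    B n j = 𝔼 {n} (λ s → δ (size s) j)

    B-suc-zero : ∀ n → B (suc n) 0 ≡ (1ℚ - t) * B n 0
    B-suc-zero n = trans
      (𝔼-cong {n} λ s → solve 2 (λ t x → t :* con 0ℚ :+ (con 1ℚ :- t) :* x := (con 1ℚ :- t) :* x) refl t (δ (size s) 0))
      (𝔼-* {n} (1ℚ - t) (λ s → δ (size s) 0))

    B-suc-suc : ∀ n j → B (suc n) (suc j) ≡ t * B n j + (1ℚ - t) * B n (suc j)
    B-suc-suc n j = trans (𝔼-+ {n} (λ s → t * δ (size s) j) (λ s → (1ℚ - t) * δ (size s) (suc j)))
      (cong₂ _+_ (𝔼-* {n} t (λ s → δ (size s) j)) (𝔼-* {n} (1ℚ - t) (λ s → δ (size s) (suc j))))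

    0≤δ : ∀ i j → 0ℚ ≤ δ i j
    0≤δ zero zero = 0≤1
    0≤δ zero (suc j) = ≤-refl
    0≤δ (suc i) zero = ≤-refl
    0≤δ (suc i) (suc j) = 0≤δ i j

    0≤B : ∀ n j → 0ℚ ≤ B n j
    0≤B n j = subst (0ℚ ≤_) (sym (𝔼-Sum {n} λ s → δ (size s) j)) (0≤Sum (allSubsets n) λ s → 0≤* (0≤weight s) (0≤δ (size s) j))

    -- With bⱼ = B n j and b′ⱼ = B (n + 1) j, the identity (j + 1)(1 - t) bⱼ₊₁ = (n - j) t bⱼ passes from n to n + 1.
    ratio-step₀ : ∀ n {b₀ b₁ b′₀ b′₁} → b′₀ ≡ (1ℚ - t) * b₀ → b′₁ ≡ t * b₀ + (1ℚ - t) * b₁ →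
      (1ℚ + 0ℚ) * (1ℚ - t) * b₁ ≡ (n - 0ℚ) * t * b₀ → (1ℚ + 0ℚ) * (1ℚ - t) * b′₁ ≡ (1ℚ + n - 0ℚ) * t * b′₀
    ratio-step₀ n {b₀} {b₁} refl refl eq = trans
      (solve 3 (λ t b c → (con 1ℚ :+ con 0ℚ) :* (con 1ℚ :- t) :* (t :* b :+ (con 1ℚ :- t) :* c) :=
          (con 1ℚ :- t) :* t :* b :+ (con 1ℚ :- t) :* ((con 1ℚ :+ con 0ℚ) :* (con 1ℚ :- t) :* c)) refl t b₀ b₁)
      (trans (cong (λ z → (1ℚ - t) * t * b₀ + (1ℚ - t) * z) eq)
      (solve 3 (λ t b n → (con 1ℚ :- t) :* t :* b :+ (con 1ℚ :- t) :* ((n :- con 0ℚ) :* t :* b) :=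
          (con 1ℚ :+ n :- con 0ℚ) :* t :* ((con 1ℚ :- t) :* b)) refl t b₀ n))

    ratio-step : ∀ n i {b₀ b₁ b₂ b′₁ b′₂} → b′₁ ≡ t * b₀ + (1ℚ - t) * b₁ → b′₂ ≡ t * b₁ + (1ℚ - t) * b₂ →
      (1ℚ + i) * (1ℚ - t) * b₁ ≡ (n - i) * t * b₀ →
      (1ℚ + (1ℚ + i)) * (1ℚ - t) * b₂ ≡ (n - (1ℚ + i)) * t * b₁ →
      (1ℚ + (1ℚ + i)) * (1ℚ - t) * b′₂ ≡ (1ℚ + n - (1ℚ + i)) * t * b′₁
    ratio-step n i {b₀} {b₁} {b₂} refl refl eq₀ eq₁ = trans
      (solve 4 (λ t i b c → (con 1ℚ :+ (con 1ℚ :+ i)) :* (con 1ℚ :- t) :* (t :* b :+ (con 1ℚ :- t) :* c) :=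
          (con 1ℚ :+ (con 1ℚ :+ i)) :* (con 1ℚ :- t) :* t :* b :+ (con 1ℚ :- t) :* ((con 1ℚ :+ (con 1ℚ :+ i)) :* (con 1ℚ :- t) :* c))
        refl t i b₁ b₂)
      (trans (cong (λ z → (1ℚ + (1ℚ + i)) * (1ℚ - t) * t * b₁ + (1ℚ - t) * z) eq₁)
      (trans (solve 4 (λ t i b n → (con 1ℚ :+ (con 1ℚ :+ i)) :* (con 1ℚ :- t) :* t :* b :+ (con 1ℚ :- t) :* ((n :- (con 1ℚ :+ i)) :* t :* b) :=
          t :* ((con 1ℚ :+ i) :* (con 1ℚ :- t) :* b) :+ (con 1ℚ :+ n :- (con 1ℚ :+ i)) :* t :* (con 1ℚ :- t) :* b)
         refl t i b₁ n)
      (trans (cong (λ z → t * z + (1ℚ + n - (1ℚ + i)) * t * (1ℚ - t) * b₁) eq₀)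
      (solve 5 (λ t i a b n → t :* ((n :- i) :* t :* a) :+ (con 1ℚ :+ n :- (con 1ℚ :+ i)) :* t :* (con 1ℚ :- t) :* b :=
          (con 1ℚ :+ n :- (con 1ℚ :+ i)) :* t :* (t :* a :+ (con 1ℚ :- t) :* b))
         refl t i b₀ b₁ n))))

    B-ratio : ∀ n j → ι (suc j) * (1ℚ - t) * B n (suc j) ≡ (ι n - ι j) * t * B n j
    B-ratio zero zero = solve 1 (λ t → (con 1ℚ :+ con 0ℚ) :* (con 1ℚ :- t) :* con 0ℚ := (con 0ℚ :- con 0ℚ) :* t :* con 1ℚ) refl t
    B-ratio zero (suc j) = solve 2 (λ t j → (con 1ℚ :+ (con 1ℚ :+ j)) :* (con 1ℚ :- t) :* con 0ℚ := (con 0ℚ :- (con 1ℚ :+ j)) :* t :* con 0ℚ) refl t (ι j)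
    B-ratio (suc n) zero = ratio-step₀ (ι n) {B n 0} {B n 1} {B (suc n) 0} {B (suc n) 1} (B-suc-zero n) (B-suc-suc n 0) (B-ratio n 0)
    B-ratio (suc n) (suc j) = ratio-step (ι n) (ι j) {B n j} {B n (suc j)} {B n (suc (suc j))} {B (suc n) (suc j)} {B (suc n) (suc (suc j))}
      (B-suc-suc n j) (B-suc-suc n (suc j)) (B-ratio n j) (B-ratio n (suc j))

    ΣB : ℕ → ℕ → ℚ
    ΣB n zero = 0ℚ
    ΣB n (suc k) = B n k + ΣB n k

    ΣB-suc-suc : ∀ n k → ΣB (suc n) (suc k) ≡ t * ΣB n k + (1ℚ - t) * ΣB n (suc k)
    ΣB-suc-suc n zero = trans (cong (_+ 0ℚ) (B-suc-zero n))
      (solve 2 (λ t b → (con 1ℚ :- t) :* b :+ con 0ℚ := t :* con 0ℚ :+ (con 1ℚ :- t) :* (b :+ con 0ℚ)) refl t (B n 0))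
    ΣB-suc-suc n (suc k) = trans (cong₂ _+_ (B-suc-suc n k) (ΣB-suc-suc n k))
      (solve 4 (λ t a b s → t :* a :+ (con 1ℚ :- t) :* b :+ (t :* s :+ (con 1ℚ :- t) :* (a :+ s)) :=
        t :* (a :+ s) :+ (con 1ℚ :- t) :* (b :+ (a :+ s))) refl t (B n k) (B n (suc k)) (ΣB n k))

    ΣB≡1 : ∀ n k → n ℕ.< k → ΣB n k ≡ 1ℚ
    ΣB≡1 zero (suc zero) _ = refl
    ΣB≡1 zero (suc (suc k)) _ = trans (+-identityˡ (ΣB 0 (suc k))) (ΣB≡1 zero (suc k) (ℕ.s≤s ℕ.z≤n))
    ΣB≡1 (suc n) (suc k) (ℕ.s≤s n<k) = trans (ΣB-suc-suc n k)
      (trans (cong₂ (λ a b → t * a + (1ℚ - t) * b) (ΣB≡1 n k n<k) (ΣB≡1 n (suc k) (ℕ.m<n⇒m<1+n n<k)))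
      (solve 1 (λ t → t :* con 1ℚ :+ (con 1ℚ :- t) :* con 1ℚ := con 1ℚ) refl t))

    ΣB≤ : ∀ {n b} k → (∀ j → j ℕ.< k → B n j ≤ b) → ΣB n k ≤ ι k * b
    ΣB≤ {b = b} zero le = ≤-reflexive (sym (*-zeroˡ b))
    ΣB≤ {n} {b} (suc k) le = ≤-trans (+-mono-≤ (le k ℕ.≤-refl) (ΣB≤ {n} {b} k λ j j<k → le j (ℕ.m<n⇒m<1+n j<k)))
      (≤-reflexive (solve 2 (λ k b → b :+ k :* b := (con 1ℚ :+ k) :* b) refl (ι k) b))

    Sum-all≡Sum-filter : ∀ {X : Set} {Q : X → Set} (Q? : Decidable Q) (xs : List X) {h g : X → ℚ} →
      (∀ x → Q x → g x ≡ h x) → (∀ x → ¬ Q x → g x ≡ 0ℚ) → Sum xs g ≡ Sum (filter Q? xs) h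
    Sum-all≡Sum-filter Q? [] _ _ = refl
    Sum-all≡Sum-filter Q? (x ∷ xs) {h} {g} eq eq0 with Q? x
    ... | yes q = cong₂ _+_ (eq x q) (Sum-all≡Sum-filter Q? xs eq eq0)
    ... | no ¬q = trans (cong₂ _+_ (eq0 x ¬q) (Sum-all≡Sum-filter Q? xs eq eq0)) (+-identityˡ (Sum (filter Q? xs) h))

    B≡numSubsets*wt : ∀ n j → B n j ≡ ι (numSubsets n j) * wt n j
    B≡numSubsets*wt n j = trans (𝔼-Sum {n} (λ s → δ (size s) j)) (trans
      (Sum-all≡Sum-filter (λ s → size s ℕ.≟ j) (allSubsets n) {λ _ → wt n j}
        (λ { s refl → trans (cong₂ _*_ (weight≡wt s) (δ-refl (size s))) (*-identityʳ (wt n (size s))) })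
        (λ s ≢j → trans (cong (weight s *_) (δ-≢ (size s) j ≢j)) (*-zeroʳ (weight s))))
      (Sum-const (subsetsOfSize n j) (wt n j)))

    Sum-filter₂ : ∀ {X : Set} {Q R : X → Set} (Q? : Decidable Q) (R? : Decidable R) (xs : List X) {h g : X → ℚ} →
      (∀ x → R x → Q x → h x ≤ g x) → (∀ x → 0ℚ ≤ g x) → Sum (filter Q? (filter R? xs)) h ≤ Sum xs g
    Sum-filter₂ Q? R? [] h≤g 0≤g = ≤-refl
    Sum-filter₂ Q? R? (x ∷ xs) {h} {g} h≤g 0≤g with R? x
    ... | no _ = ≤-trans (Sum-filter₂ Q? R? xs h≤g 0≤g) (≤-by (g x) (0≤g x) (+-comm (g x) (Sum xs g)))
    ... | yes r with Q? x
    ...   | no _ = ≤-trans (Sum-filter₂ Q? R? xs h≤g 0≤g) (≤-by (g x) (0≤g x) (+-comm (g x) (Sum xs g)))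
    ...   | yes q = +-mono-≤ (h≤g x r q) (Sum-filter₂ Q? R? xs h≤g 0≤g)

    -- All m-sets have the same weight `wt n m`, so counting bad m-sets amounts to measuring them;
    -- the rest of the cube contributes nonnegatively to `𝔼 H`.
    markov : ∀ {n a} m {Q : Vec Bool n → Set} (Q? : Decidable Q) (H : Vec Bool n → ℚ) → (∀ s → 0ℚ ≤ H s) →
      (∀ s → size s ≡ m → Q s → a ≤ H s) → ι (length (filter Q? (subsetsOfSize n m))) * (wt n m * a) ≤ 𝔼 H
    markov {n} {a} m Q? H 0≤H a≤H = subst₂ _≤_ (Sum-const (filter Q? (subsetsOfSize n m)) (wt n m * a)) (sym (𝔼-Sum H))
      (Sum-filter₂ Q? (λ s → size s ℕ.≟ m) (allSubsets n)
        (λ { s refl q → ≤-trans (≤-reflexive (cong (_* a) (sym (weight≡wt s)))) (*-monoʳ (0≤weight s) (a≤H s refl q)) })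
        (λ s → 0≤* (0≤weight s) (0≤H s)))

    ∑f≡ : ∀ {n} (s : Vec Bool n) → ∑ f s ≡ ι (size s) - t * ι n
    ∑f≡ [] = solve 1 (λ t → con 0ℚ := con 0ℚ :- t :* con 0ℚ) refl t
    ∑f≡ {suc n} (true ∷ s) = trans (cong (1ℚ - t +_) (∑f≡ s))
      (solve 3 (λ t m n → con 1ℚ :- t :+ (m :- t :* n) := con 1ℚ :+ m :- t :* (con 1ℚ :+ n)) refl t (ι (size s)) (ι n))
    ∑f≡ {suc n} (false ∷ s) = trans (cong (- t +_) (∑f≡ s))
      (solve 3 (λ t m n → :- t :+ (m :- t :* n) := m :- t :* (con 1ℚ :+ n)) refl t (ι (size s)) (ι n))

    ∑f²≡ : ∀ {n} (s : Vec Bool n) → ∑ f² s ≡ ι (size s) * (1ℚ - t - t) + t * (t * ι n)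
    ∑f²≡ [] = solve 1 (λ t → con 0ℚ := con 0ℚ :* (con 1ℚ :- t :- t) :+ t :* (t :* con 0ℚ)) refl t
    ∑f²≡ {suc n} (true ∷ s) = trans (cong (f² true +_) (∑f²≡ s))
      (solve 3 (λ t m n → (con 1ℚ :- t) :* (con 1ℚ :- t) :+ (m :* (con 1ℚ :- t :- t) :+ t :* (t :* n)) :=
        (con 1ℚ :+ m) :* (con 1ℚ :- t :- t) :+ t :* (t :* (con 1ℚ :+ n))) refl t (ι (size s)) (ι n))
    ∑f²≡ {suc n} (false ∷ s) = trans (cong (f² false +_) (∑f²≡ s))
      (solve 3 (λ t m n → :- t :* :- t :+ (m :* (con 1ℚ :- t :- t) :+ t :* (t :* n)) :=
        m :* (con 1ℚ :- t :- t) :+ t :* (t :* (con 1ℚ :+ n))) refl t (ι (size s)) (ι n))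

    ∑∣f∣≡ : ∀ {n} (s : Vec Bool n) → ∑ ∣f∣ s ≡ ι (size s) * (1ℚ - t - t) + t * ι n
    ∑∣f∣≡ [] = solve 1 (λ t → con 0ℚ := con 0ℚ :* (con 1ℚ :- t :- t) :+ t :* con 0ℚ) refl t
    ∑∣f∣≡ {suc n} (true ∷ s) = trans (cong₂ _+_ (0≤p⇒∣p∣≡p 0≤1-t) (∑∣f∣≡ s))
      (solve 3 (λ t m n → con 1ℚ :- t :+ (m :* (con 1ℚ :- t :- t) :+ t :* n) :=
        (con 1ℚ :+ m) :* (con 1ℚ :- t :- t) :+ t :* (con 1ℚ :+ n)) refl t (ι (size s)) (ι n))
    ∑∣f∣≡ {suc n} (false ∷ s) = trans (cong₂ _+_ (trans (∣-p∣≡∣p∣ t) (0≤p⇒∣p∣≡p 0≤t)) (∑∣f∣≡ s))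
      (solve 3 (λ t m n → t :+ (m :* (con 1ℚ :- t :- t) :+ t :* n) :=
        m :* (con 1ℚ :- t :- t) :+ t :* (con 1ℚ :+ n)) refl t (ι (size s)) (ι n))

    module _ {N m : ℕ} (tN≡m : t * ι N ≡ ι m) (1≤m : 1 ℕ.≤ m) (m≤N : m ℕ.≤ N) where

      private
        M = ι m

      0<t : 0ℚ < t
      0<t = *-cancelʳ-<-nonNeg (ι N) {{nonNegative (0≤ι N)}} (subst₂ _<_ (sym (*-zeroˡ (ι N))) (sym tN≡m) (0<ι 1≤m))

      t<1 : m ℕ.< N → 0ℚ < 1ℚ - t
      t<1 m<N = *-cancelʳ-<-nonNeg (ι N) {{nonNegative (0≤ι N)}} (subst₂ _<_ (sym (*-zeroˡ (ι N)))
        (trans (cong (λ z → ι N - z) (sym tN≡m)) (solve 2 (λ n t → n :- t :* n := (con 1ℚ :- t) :* n) refl (ι N) t))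
        (subst (_< ι N - M) (+-inverseʳ M) (+-monoˡ-< (- M) (ι-mono-< m<N))))

      0<* : ∀ {p q} → 0ℚ < p → 0ℚ < q → 0ℚ < p * q
      0<* {p} {q} 0<p 0<q = subst (_< p * q) (*-zeroʳ p) (*-monoʳ-<-pos p {{positive 0<p}} 0<q)

      -- As tN = m, the two coefficients in `B-ratio` differ by (N - j) t - (j + 1)(1 - t) = m - (j
      -- + 1) + t, which is nonnegative for j < m. In `B-down` the opposite difference is j - m + (1
      -- - t).
      B-up : ∀ j → j ℕ.< m → B N j ≤ B N (suc j)
      B-up j j<m = *-cancelʳ {(ι N - ι j) * t} (0<* 0<N-j 0<t) (begin
        B N j * ((ι N - ι j) * t)                  ≡⟨ *-comm (B N j) ((ι N - ι j) * t) ⟩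
        (ι N - ι j) * t * B N j                    ≡⟨ B-ratio N j ⟨
        ι (suc j) * (1ℚ - t) * B N (suc j)         ≤⟨ *-monoˡ (0≤B N (suc j)) le ⟩
        (ι N - ι j) * t * B N (suc j)              ≡⟨ *-comm ((ι N - ι j) * t) (B N (suc j)) ⟩
        B N (suc j) * ((ι N - ι j) * t)            ∎)
        where
        open ≤-Reasoning
        0<N-j : 0ℚ < ι N - ι j
        0<N-j = subst (_< ι N - ι j) (+-inverseʳ (ι j)) (+-monoˡ-< (- ι j) (ι-mono-< (ℕ.<-≤-trans j<m m≤N)))
        le : ι (suc j) * (1ℚ - t) ≤ (ι N - ι j) * t
        le = ≤-by (M - ι (suc j) + t) (0≤+ (p≤q⇒0≤q-p (ι-mono j<m)) 0≤t) (trans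
          (solve 3 (λ n j t → (n :- j) :* t := t :* n :- j :* t) refl (ι N) (ι j) t)
          (trans (cong (_- ι j * t) tN≡m)
          (solve 3 (λ m j t → m :- j :* t := (con 1ℚ :+ j) :* (con 1ℚ :- t) :+ (m :- (con 1ℚ :+ j) :+ t)) refl M (ι j) t)))

      B-down : ∀ j → m ℕ.≤ j → j ℕ.< N → B N (suc j) ≤ B N j
      B-down j m≤j j<N = *-cancelʳ {ι (suc j) * (1ℚ - t)} (0<* (0<ι {suc j} (ℕ.s≤s ℕ.z≤n)) (t<1 (ℕ.≤-<-trans m≤j j<N))) (begin
        B N (suc j) * (ι (suc j) * (1ℚ - t))       ≡⟨ *-comm (B N (suc j)) (ι (suc j) * (1ℚ - t)) ⟩
        ι (suc j) * (1ℚ - t) * B N (suc j)         ≡⟨ B-ratio N j ⟩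
        (ι N - ι j) * t * B N j                    ≤⟨ *-monoˡ (0≤B N j) le ⟩
        ι (suc j) * (1ℚ - t) * B N j               ≡⟨ *-comm (ι (suc j) * (1ℚ - t)) (B N j) ⟩
        B N j * (ι (suc j) * (1ℚ - t))             ∎)
        where
        open ≤-Reasoning
        le : (ι N - ι j) * t ≤ ι (suc j) * (1ℚ - t)
        le = ≤-by (ι j - M + (1ℚ - t)) (0≤+ (p≤q⇒0≤q-p (ι-mono m≤j)) 0≤1-t) (trans
          (solve 3 (λ m j t → (con 1ℚ :+ j) :* (con 1ℚ :- t) := m :- j :* t :+ (j :- m :+ (con 1ℚ :- t))) refl M (ι j) t)
          (trans (cong (λ z → z - ι j * t + (ι j - M + (1ℚ - t))) (sym tN≡m))
          (solve 4 (λ n j t m → t :* n :- j :* t :+ (j :- m :+ (con 1ℚ :- t)) := (n :- j) :* t :+ (j :- m :+ (con 1ℚ :- t))) refl (ι N) (ι j) t M)))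

      mode : ∀ j → j ℕ.< suc N → B N j ≤ B N m
      mode j (ℕ.s≤s j≤N) with ℕ.≤-total j m
      ... | inj₁ j≤m = up (m ℕ.∸ j) (ℕ.m+[n∸m]≡n j≤m)
        where
        up : ∀ d {j} → j ℕ.+ d ≡ m → B N j ≤ B N m
        up zero {j} eq = ≤-reflexive (cong (B N) (trans (sym (ℕ.+-identityʳ j)) eq))
        up (suc d) {j} eq = ≤-trans (B-up j (ℕ.≤-trans (ℕ.m≤m+n (suc j) d) (ℕ.≤-reflexive eq′))) (up d eq′)
          where eq′ = trans (sym (ℕ.+-suc j d)) eq
      ... | inj₂ m≤j = subst (λ j → B N j ≤ B N m) (ℕ.m∸n+n≡m m≤j)
              (down (j ℕ.∸ m) (ℕ.≤-trans (ℕ.≤-reflexive (ℕ.m∸n+n≡m m≤j)) j≤N))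
        where
        down : ∀ d → d ℕ.+ m ℕ.≤ N → B N (d ℕ.+ m) ≤ B N m
        down zero _ = ≤-refl
        down (suc d) le = ≤-trans (B-down (d ℕ.+ m) (ℕ.m≤n+m m d) le) (down d (ℕ.<⇒≤ le))

      -- The N + 1 possible sizes carry total mass 1, and none carries more than m.
      1≤[N+1]*numSubsets*wt : 1ℚ ≤ ι (suc N) * (ι (numSubsets N m) * wt N m)
      1≤[N+1]*numSubsets*wt = subst₂ _≤_ (ΣB≡1 N (suc N) (ℕ.n<1+n N)) (cong (ι (suc N) *_) (B≡numSubsets*wt N m)) (ΣB≤ {N} (suc N) mode)

      module _ (s : Vec Bool N) (size≡m : size s ≡ m) where

        ∑f≡0 : ∑ f s ≡ 0ℚ
        ∑f≡0 = trans (∑f≡ s) (trans (cong₂ _-_ (cong ι size≡m) tN≡m) (+-inverseʳ M))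

        -- The exact value is m (1 - t), by t N = m.
        ∑f²≤m : ∑ f² s ≤ M
        ∑f²≤m = ≤-trans (≤-reflexive (trans (∑f²≡ s) (cong₂ (λ a b → a * (1ℚ - t - t) + t * b) (cong ι size≡m) tN≡m)))
          (≤-by (t * M) (0≤* 0≤t (0≤ι m)) (solve 2 (λ t m → m := m :* (con 1ℚ :- t :- t) :+ t :* m :+ t :* m) refl t M))

        ∑∣f∣≤2m : ∑ ∣f∣ s ≤ M + M
        ∑∣f∣≤2m = ≤-trans (≤-reflexive (trans (∑∣f∣≡ s) (cong₂ (λ a b → a * (1ℚ - t - t) + b) (cong ι size≡m) tN≡m)))
          (≤-by (t * M + t * M) (0≤+ (0≤* 0≤t (0≤ι m)) (0≤* 0≤t (0≤ι m)))
            (solve 2 (λ t m → m :+ m := m :* (con 1ℚ :- t :- t) :+ m :+ (t :* m :+ t :* m)) refl t M))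

  -- An integer substitute for √n up to a factor 2. Raising h only when 4h² ≤ n leaves room for (h +
  -- 1)² ≤ n + 1.
  ∃-half-sqrt : ∀ n → Σ ℕ λ h → h ℕ.* h ℕ.≤ n × n ℕ.≤ 4 ℕ.* (h ℕ.* h)
  ∃-half-sqrt zero = 0 , ℕ.z≤n , ℕ.z≤n
  ∃-half-sqrt (suc n) with ∃-half-sqrt n
  ... | h , h²≤n , n≤4h² with suc n ℕ.≤? 4 ℕ.* (h ℕ.* h)
  ...   | yes n<4h² = h , ℕ.m≤n⇒m≤1+n h²≤n , n<4h²
  ...   | no n≮4h² = suc h , h′²≤ h (ℕ.≤-pred (ℕ.≰⇒> n≮4h²)) , ℕ.≤-trans (ℕ.s≤s n≤4h²) (bound h)
    where
    bound : ∀ h → suc (4 ℕ.* (h ℕ.* h)) ℕ.≤ 4 ℕ.* (suc h ℕ.* suc h)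
    bound h = subst (suc (4 ℕ.* (h ℕ.* h)) ℕ.≤_) (eq h) (ℕ.m≤m+n (suc (4 ℕ.* (h ℕ.* h))) (3 ℕ.+ 8 ℕ.* h))
      where
      eq : ∀ h → suc (4 ℕ.* (h ℕ.* h)) ℕ.+ (3 ℕ.+ 8 ℕ.* h) ≡ 4 ℕ.* (suc h ℕ.* suc h)
      eq = solve-∀
    h′²≤ : ∀ h → 4 ℕ.* (h ℕ.* h) ℕ.≤ n → suc h ℕ.* suc h ℕ.≤ suc n
    h′²≤ zero _ = ℕ.s≤s ℕ.z≤n
    h′²≤ (suc h) 4h²≤n = ℕ.≤-trans
      (subst (suc (suc h) ℕ.* suc (suc h) ℕ.≤_) (eq h) (ℕ.m≤m+n _ (1 ℕ.+ 3 ℕ.* (h ℕ.* h) ℕ.+ 4 ℕ.* h)))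
      (ℕ.s≤s 4h²≤n)
      where
      eq : ∀ h → suc (suc h) ℕ.* suc (suc h) ℕ.+ (1 ℕ.+ 3 ℕ.* (h ℕ.* h) ℕ.+ 4 ℕ.* h) ≡ suc (4 ℕ.* (suc h ℕ.* suc h))
      eq = solve-∀

  ι-^ : ∀ a n → ι (a ℕ.^ n) ≡ pow (ι a) n
  ι-^ a zero = refl
  ι-^ a (suc n) = trans (ι-* a (a ℕ.^ n)) (cong (ι a *_) (ι-^ a n))

  square-cancel-≤ : ∀ {h m} → h ℕ.* h ℕ.≤ m ℕ.* m → h ℕ.≤ m
  square-cancel-≤ {h} {m} le with h ℕ.≤? m
  ... | yes h≤m = h≤m
  ... | no h≰m = ⊥-elim (ℕ.<⇒≱ (ℕ.*-mono-< (ℕ.≰⇒> h≰m) (ℕ.≰⇒> h≰m)) le)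

  -- The choice of the exponents and the tail bound

  module Tail (t : ℚ) (0≤t : 0ℚ ≤ t) (t≤1 : t ≤ 1ℚ)
    {N m : ℕ} (tN≡m : t * ι N ≡ ι m) (1≤m : 1 ℕ.≤ m) (m≤N : m ℕ.≤ N) where

    open Bernoulli t 0≤t t≤1
    open Hypergraph t 0≤t t≤1
    open Counting t 0≤t t≤1

    module _ {ρ : ℚ} {κ : ℕ} (1≤κ : 1 ℕ.≤ κ) {Φ : Vec Bool N → ℚ}
      (means : Each (λ G → 𝔼 G ≡ ρ) (grad Φ)) (smooth : Each (λ G → Each (Bounded (ι κ)) (grad G)) (grad Φ)) where

      deviation≤ : ∀ s → size s ≡ m → ∣ Φ s - 𝔼 Φ ∣ ≤ ι (4 ℕ.* κ ℕ.* (m ℕ.* m))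
      deviation≤ s size≡m = ≤-trans
        (deviation-bound {ρ} {ι κ} {Φ = Φ} (0≤ι κ) means smooth s (∑f≡0 tN≡m 1≤m m≤N s size≡m) (∑∣f∣≤2m tN≡m 1≤m m≤N s size≡m))
        (≤-reflexive (trans (solve 2 (λ k m → k :* (m :+ m) :* (m :+ m) := con (ι 4) :* k :* (m :* m)) refl (ι κ) (ι m))
          (sym (trans (ι-* (4 ℕ.* κ) (m ℕ.* m)) (cong₂ _*_ (ι-* 4 κ) (ι-* m m))))))

      module _ (A : ℕ) {Q : Vec Bool N → Set} (Q? : Decidable Q)
        (Q⇒large : ∀ s → size s ≡ m → Q s → ι (36 ℕ.* κ ℕ.* (m ℕ.* A)) ≤ ∣ Φ s - 𝔼 Φ ∣) where

        private
          a = ι A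
          k = ι κ
          M = ι m
          bad = length (filter Q? (subsetsOfSize N m))
          C = numSubsets N m

        ι-x : ι (36 ℕ.* κ ℕ.* (m ℕ.* A)) ≡ ι 36 * k * (M * a)
        ι-x = trans (ι-* (36 ℕ.* κ) (m ℕ.* A)) (cong₂ _*_ (ι-* 36 κ) (ι-* m A))

        1≤2κm : 1 ℕ.≤ 2 ℕ.* κ ℕ.* m
        1≤2κm = ℕ.*-mono-≤ (ℕ.*-mono-≤ {1} {2} (ℕ.s≤s ℕ.z≤n) 1≤κ) 1≤m

        1≤18κm : 1 ℕ.≤ 18 ℕ.* κ ℕ.* m
        1≤18κm = ℕ.*-mono-≤ (ℕ.*-mono-≤ {1} {18} (ℕ.s≤s ℕ.z≤n) 1≤κ) 1≤m

        -- The factor 2 (N + 1) is the expectation of the detector; the other N + 1 pays for the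
        -- passage from the cube to m-subsets.
        count-from-W : ∀ (H : Vec Bool N → ℚ) → (∀ s → 0ℚ ≤ H s) → 𝔼 H ≡ ι (suc N) * 2ℚ →
          (∀ s → size s ≡ m → Q s → pow 2ℚ A ≤ H s) → bad ℕ.* 2 ℕ.^ A ℕ.≤ 2 ℕ.* (suc N ℕ.* suc N) ℕ.* C
        count-from-W H 0≤H 𝔼H large = ι-cancel-≤ (begin
          ι (bad ℕ.* 2 ℕ.^ A)                               ≡⟨ trans (ι-* bad (2 ℕ.^ A)) (cong (ι bad *_) (ι-^ 2 A)) ⟩
          ι bad * p                                         ≡⟨ *-identityʳ (ι bad * p) ⟨
          ι bad * p * 1ℚ                                    ≤⟨ *-monoʳ (0≤* (0≤ι bad) (0≤pow A (0≤ι 2))) (1≤[N+1]*numSubsets*wt tN≡m 1≤m m≤N) ⟩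
          ι bad * p * (ι (suc N) * (ι C * wt N m))
            ≡⟨ solve 5 (λ b p n c w → b :* p :* (n :* (c :* w)) := b :* (w :* p) :* (n :* c)) refl (ι bad) p (ι (suc N)) (ι C) (wt N m) ⟩
          ι bad * (wt N m * p) * (ι (suc N) * ι C)
            ≤⟨ *-monoˡ (0≤* (0≤ι (suc N)) (0≤ι C)) (markov m Q? H 0≤H large) ⟩
          𝔼 H * (ι (suc N) * ι C)                           ≡⟨ cong (_* (ι (suc N) * ι C)) 𝔼H ⟩
          ι (suc N) * 2ℚ * (ι (suc N) * ι C)
            ≡⟨ solve 2 (λ n c → n :* con 2ℚ :* (n :* c) := con (ι 2) :* (n :* n) :* c) refl (ι (suc N)) (ι C) ⟩
          ι 2 * (ι (suc N) * ι (suc N)) * ι C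
            ≡⟨ trans (ι-* (2 ℕ.* (suc N ℕ.* suc N)) C) (cong (_* ι C) (trans (ι-* 2 (suc N ℕ.* suc N)) (cong (ι 2 *_) (ι-* (suc N) (suc N))))) ⟨
          ι (2 ℕ.* (suc N ℕ.* suc N) ℕ.* C)                 ∎)
          where
          open ≤-Reasoning
          p = pow 2ℚ A

        -- Up to a factor 2, h is √(mA).  The bound S = 9κh on ∣ G_x - ρ ∣ is forced by the exponent μ = h / (2κm),
        -- and the bound 36κmA on the deviation of Φ by the exponent c = 1 / (18κm).
        module _ (h : ℕ) (h²≤mA : h ℕ.* h ℕ.≤ m ℕ.* A) (mA≤4h² : m ℕ.* A ℕ.≤ 4 ℕ.* (h ℕ.* h)) (h≤m : h ℕ.≤ m)
          (c : ℚ) (c-eq : c * ι (18 ℕ.* κ ℕ.* m) ≡ 1ℚ) (μ : ℚ) (μ-eq : μ * ι (2 ℕ.* κ ℕ.* m) ≡ ι h) where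

          η = ι h
          S = ι 9 * k * η

          0≤c : 0ℚ ≤ c
          0≤c = 0≤quotient {x = c} 1≤18κm c-eq 0≤1

          0≤μ : 0ℚ ≤ μ
          0≤μ = 0≤quotient {x = μ} 1≤2κm μ-eq (0≤ι h)

          c-eq′ : c * (ι 18 * k * M) ≡ 1ℚ
          c-eq′ = trans (cong (c *_) (sym (trans (ι-* (18 ℕ.* κ) m) (cong (_* M) (ι-* 18 κ))))) c-eq

          μ-eq′ : μ * (ι 2 * k * M) ≡ η
          μ-eq′ = trans (cong (μ *_) (sym (trans (ι-* (2 ℕ.* κ) m) (cong (_* M) (ι-* 2 κ))))) μ-eq

          η²≤Ma : η * η ≤ M * a
          η²≤Ma = subst₂ _≤_ (ι-* h h) (ι-* m A) (ι-mono h²≤mA)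

          Ma≤4η² : M * a ≤ ι 4 * (η * η)
          Ma≤4η² = subst₂ _≤_ (ι-* m A) (trans (ι-* 4 (h ℕ.* h)) (cong (ι 4 *_) (ι-* h h))) (ι-mono mA≤4h²)

          cS-small : c * S + c * S ≤ 1ℚ
          cS-small = begin
            c * S + c * S         ≡⟨ solve 3 (λ c k h → c :* (con (ι 9) :* k :* h) :+ c :* (con (ι 9) :* k :* h) := c :* (con (ι 18) :* k :* h)) refl c k η ⟩
            c * (ι 18 * k * η)    ≤⟨ *-monoʳ 0≤c (*-monoʳ (0≤* {ι 18} (0≤ι 18) (0≤ι κ)) (ι-mono h≤m)) ⟩
            c * (ι 18 * k * M)    ≡⟨ c-eq′ ⟩
            1ℚ                    ∎
            where open ≤-Reasoning

          μκ-small : μ * k + μ * k ≤ 1ℚ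
          μκ-small = *-cancelʳ (0<ι 1≤m) (begin
            (μ * k + μ * k) * M   ≡⟨ solve 3 (λ c k m → (c :* k :+ c :* k) :* m := c :* (con (ι 2) :* k :* m)) refl μ k M ⟩
            μ * (ι 2 * k * M)     ≡⟨ μ-eq′ ⟩
            η                     ≤⟨ ι-mono h≤m ⟩
            M                     ≡⟨ *-identityˡ M ⟨
            1ℚ * M                ∎)
            where open ≤-Reasoning

          -- The linear term is exactly 2A, because 36κmA is 2A times 18κm; the quadratic loss `q`
          -- may therefore use up A.
          cond₁ : a ≤ c * (ι 36 * k * (M * a)) - 2ℚ * (c * S * (c * S) * M)
          cond₁ = ≤-by (a - q) (p≤q⇒0≤q-p q≤a) (trans
            (cong (_- q) (trans (solve 4 (λ c k m a → c :* (con (ι 36) :* k :* (m :* a)) := c :* (con (ι 18) :* k :* m) :* (a :+ a)) refl c k M a)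
              (trans (cong (_* (a + a)) c-eq′) (*-identityˡ (a + a)))))
            (solve 2 (λ a q → a :+ a :- q := a :+ (a :- q)) refl a q))
            where
            open ≤-Reasoning
            q = 2ℚ * (c * S * (c * S) * M)
            0≤q : 0ℚ ≤ q
            0≤q = 0≤* {2ℚ} (0≤ι 2) (0≤* (0≤p*p (c * S)) (0≤ι m))
            q≤a : q ≤ a
            q≤a = begin
              -- Doubling `q` turns its coefficient into 18², so that `c-eq′` applies twice.
              q                                       ≤⟨ ≤-by q 0≤q refl ⟩
              q + q
                ≡⟨ solve 4 (λ c k h m → con 2ℚ :* (c :* (con (ι 9) :* k :* h) :* (c :* (con (ι 9) :* k :* h)) :* m) :+
                      con 2ℚ :* (c :* (con (ι 9) :* k :* h) :* (c :* (con (ι 9) :* k :* h)) :* m) :=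
                      con (ι 18) :* con (ι 18) :* (c :* k :* (c :* k) :* m) :* (h :* h)) refl c k η M ⟩
              ι 18 * ι 18 * (c * k * (c * k) * M) * (η * η)
                ≤⟨ *-monoʳ (0≤* {ι 18 * ι 18} (0≤* {ι 18} {ι 18} (0≤ι 18) (0≤ι 18)) (0≤* (0≤p*p (c * k)) (0≤ι m))) η²≤Ma ⟩
              ι 18 * ι 18 * (c * k * (c * k) * M) * (M * a)
                ≡⟨ solve 4 (λ c k m a → con (ι 18) :* con (ι 18) :* (c :* k :* (c :* k) :* m) :* (m :* a) :=
                      c :* (con (ι 18) :* k :* m) :* (c :* (con (ι 18) :* k :* m)) :* a) refl c k M a ⟩
              c * (ι 18 * k * M) * (c * (ι 18 * k * M)) * a   ≡⟨ cong (λ z → z * z * a) c-eq′ ⟩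
              1ℚ * 1ℚ * a                                      ≡⟨ *-identityˡ a ⟩
              a                                       ∎

          -- Here μS = 9h² / 2m and the quadratic loss is h² / 2m, leaving 4h² / m. The 9 in `S` is
          -- chosen to compensate the factor 4 in mA ≤ 4h².
          cond₂ : a ≤ μ * S - 2ℚ * (μ * k * (μ * k) * M)
          cond₂ = *-cancelʳ (0<ι 1≤m) (begin
            a * M                                     ≡⟨ *-comm a M ⟩
            M * a                                     ≤⟨ Ma≤4η² ⟩
            ι 4 * (η * η)                             ≡⟨ solve 1 (λ h → con (ι 4) :* (h :* h) := con (ι 5) :* (h :* h) :- h :* h) refl η ⟩
            ι 5 * (η * η) - η * η                     ≡⟨ cong (λ z → ι 5 * (z * z) - z * z) (sym μ-eq′) ⟩
            ι 5 * (η′ * η′) - η′ * η′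
              ≡⟨ solve 3 (λ u k m → con (ι 5) :* (u :* (con (ι 2) :* k :* m) :* (u :* (con (ι 2) :* k :* m))) :- u :* (con (ι 2) :* k :* m) :* (u :* (con (ι 2) :* k :* m)) :=
                   (u :* (con (ι 9) :* k :* (u :* (con (ι 2) :* k :* m))) :- con 2ℚ :* (u :* k :* (u :* k) :* m)) :* m) refl μ k M ⟩
            (μ * (ι 9 * k * η′) - 2ℚ * (μ * k * (μ * k) * M)) * M
              ≡⟨ cong (λ z → (μ * (ι 9 * k * z) - 2ℚ * (μ * k * (μ * k) * M)) * M) μ-eq′ ⟩
            (μ * S - 2ℚ * (μ * k * (μ * k) * M)) * M  ∎)
            where
            open ≤-Reasoning
            η′ = μ * (ι 2 * k * M)

          count-bounded-A : bad ℕ.* 2 ℕ.^ A ℕ.≤ 2 ℕ.* (suc N ℕ.* suc N) ℕ.* C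
          count-bounded-A = count-from-W (W {ρ} {k} c S μ Φ)
            (0≤W {ρ} {k} 0≤c 0≤S 0≤μ cS-small μκ-small means smooth)
            (𝔼-W {ρ} {k} c S μ Φ)
            (λ s size≡m q → W-large {ρ} {k} 0≤c 0≤S 0≤μ cS-small μκ-small means smooth A cond₁ cond₂
               (∑f≡0 tN≡m 1≤m m≤N s size≡m) (∑f²≤m tN≡m 1≤m m≤N s size≡m) (subst (_≤ ∣ Φ s - 𝔼 Φ ∣) ι-x (Q⇒large s size≡m q)))
            where
            0≤S : 0ℚ ≤ S
            0≤S = 0≤* {ι 9 * k} (0≤* {ι 9} (0≤ι 9) (0≤ι κ)) (0≤ι h)

        large-deviation-count : bad ℕ.* 2 ℕ.^ A ℕ.≤ 2 ℕ.* (suc N ℕ.* suc N) ℕ.* C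
        large-deviation-count with A ℕ.≤? m
        ... | yes A≤m with ∃-half-sqrt (m ℕ.* A) | quotient 1ℚ (18 ℕ.* κ ℕ.* m) 1≤18κm
        ...   | h , h²≤ , ≤4h² | c , c-eq with quotient (ι h) (2 ℕ.* κ ℕ.* m) 1≤2κm
        ...     | μ , μ-eq = count-bounded-A h h²≤ ≤4h² (square-cancel-≤ (ℕ.≤-trans h²≤ (ℕ.*-monoʳ-≤ m A≤m))) c c-eq μ μ-eq
        -- For A > m the threshold 36κmA exceeds the worst case 4κm², so there are no bad sets.
        large-deviation-count | no A≰m = ℕ.≤-trans (ℕ.≤-reflexive (cong (ℕ._* 2 ℕ.^ A)
            (cong length (filter-none Q? (All.map (λ {s} → impossible s) (all-filter (λ s → size s ℕ.≟ m) (allSubsets N))))))) ℕ.z≤n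
          where
          impossible : ∀ s → size s ≡ m → ¬ Q s
          impossible s size≡m q = ℕ.<⇒≱ (ℕ.*-mono-< (ℕ.*-monoˡ-< κ {{ℕ.>-nonZero 1≤κ}} (ℕ.m≤m+n 5 31)) (ℕ.*-monoʳ-< m {{ℕ.>-nonZero 1≤m}} (ℕ.≰⇒> A≰m)))
            (ι-cancel-≤ (≤-trans (Q⇒large s size≡m q) (deviation≤ s size≡m)))

  -- From the binomial mean to the mean over m-subsets

  ι-sum : ∀ {X : Set} (num : X → ℕ) xs → ι (sum (map num xs)) ≡ Sum xs (λ x → ι (num x))
  ι-sum num [] = refl
  ι-sum num (x ∷ xs) = trans (ι-+ (num x) (sum (map num xs))) (cong (ι (num x) +_) (ι-sum num xs))

  ι-∸ : ∀ {i j} → i ℕ.≤ j → ι (j ℕ.∸ i) ≡ ι j - ι i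
  ι-∸ {i} {j} i≤j = trans (solve 2 (λ a b → a := a :+ b :- b) refl (ι (j ℕ.∸ i)) (ι i))
    (cong (_- ι i) (trans (sym (ι-+ (j ℕ.∸ i) i)) (cong ι (ℕ.m∸n+n≡m i≤j))))

  ι-∣-∣ : ∀ i j → ι ℕ.∣ i - j ∣ ≡ ∣ ι i - ι j ∣
  ι-∣-∣ i j with ℕ.≤-total i j
  ... | inj₁ i≤j = trans (cong ι (ℕ.m≤n⇒∣m-n∣≡n∸m i≤j)) (trans (ι-∸ i≤j)
          (trans (sym (0≤p⇒∣p∣≡p (p≤q⇒0≤q-p (ι-mono i≤j)))) (trans (sym (∣-p∣≡∣p∣ (ι j - ι i)))
          (cong ∣_∣ (solve 2 (λ a b → :- (b :- a) := a :- b) refl (ι i) (ι j))))))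
  ... | inj₂ j≤i = trans (cong ι (ℕ.m≤n⇒∣n-m∣≡n∸m j≤i)) (trans (ι-∸ j≤i)
          (sym (0≤p⇒∣p∣≡p (p≤q⇒0≤q-p (ι-mono j≤i)))))

  length-filter-mono : ∀ {X : Set} {Q R : X → Set} (Q? : Decidable Q) (R? : Decidable R) {xs : List X} →
    All (λ x → Q x → R x) xs → length (filter Q? xs) ℕ.≤ length (filter R? xs)
  length-filter-mono Q? R? [] = ℕ.z≤n
  length-filter-mono Q? R? {x ∷ xs} (imp ∷ imps) with Q? x | R? x
  ... | yes _ | yes _ = ℕ.s≤s (length-filter-mono Q? R? imps)
  ... | yes q | no ¬r = ⊥-elim (¬r (imp q))
  ... | no _  | yes _ = ℕ.m≤n⇒m≤1+n (length-filter-mono Q? R? imps)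
  ... | no _  | no _ = length-filter-mono Q? R? imps

  Sum-split : ∀ {X : Set} {Q : X → Set} (Q? : Decidable Q) {h : X → ℚ} {τ b : ℚ} {xs : List X} → 0ℚ ≤ τ →
    All (λ x → h x ≤ b) xs → (∀ x → ¬ Q x → h x ≤ τ) → Sum xs h ≤ ι (length xs) * τ + ι (length (filter Q? xs)) * b
  Sum-split Q? {τ = τ} {b} {[]} _ _ _ = ≤-reflexive (solve 2 (λ t b → con 0ℚ := con 0ℚ :* t :+ con 0ℚ :* b) refl τ b)
  Sum-split Q? {h} {τ} {b} {x ∷ xs} 0≤τ (hx≤b ∷ h≤b) h≤τ with Q? x
  ... | yes _ = ≤-trans (+-mono-≤ hx≤b (Sum-split Q? {h} {xs = xs} 0≤τ h≤b h≤τ))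
    (≤-by τ 0≤τ (solve 4 (λ n r t b → (con 1ℚ :+ n) :* t :+ (con 1ℚ :+ r) :* b := b :+ (n :* t :+ r :* b) :+ t) refl (ι (length xs)) (ι (length (filter Q? xs))) τ b))
  ... | no ¬q = ≤-trans (+-mono-≤ (h≤τ x ¬q) (Sum-split Q? {h} {xs = xs} 0≤τ h≤b h≤τ))
    (≤-reflexive (solve 4 (λ n r t b → t :+ (n :* t :+ r :* b) := (con 1ℚ :+ n) :* t :+ r :* b) refl (ι (length xs)) (ι (length (filter Q? xs))) τ b))

  ∣Sum∣≤Sum∣∣ : ∀ {X : Set} (xs : List X) (h : X → ℚ) → ∣ Sum xs h ∣ ≤ Sum xs (λ x → ∣ h x ∣)
  ∣Sum∣≤Sum∣∣ [] h = ≤-refl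
  ∣Sum∣≤Sum∣∣ (x ∷ xs) h = ≤-trans (∣p+q∣≤∣p∣+∣q∣ (h x) (Sum xs h)) (+-monoʳ-≤ ∣ h x ∣ (∣Sum∣≤Sum∣∣ xs h))

  Sum-shift : ∀ {X : Set} (xs : List X) (h : X → ℚ) e → Sum xs (λ x → h x - e) ≡ Sum xs h - ι (length xs) * e
  Sum-shift [] h e = solve 1 (λ e → con 0ℚ := con 0ℚ :- con 0ℚ :* e) refl e
  Sum-shift (x ∷ xs) h e = trans (cong (h x - e +_) (Sum-shift xs h e))
    (solve 4 (λ h s n e → h :- e :+ (s :- n :* e) := h :+ s :- (con 1ℚ :+ n) :* e) refl (h x) (Sum xs h) (ι (length xs)) e)

  -- If few s deviate from e by more than τ, then the mean of num is close to e,
  -- so that a deviation from the mean forces a deviation from e.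
  module Recentre {X : Set} (xs : List X) (num : X → ℕ) (e : ℚ) (b τ : ℕ) (1≤τ : 1 ℕ.≤ τ)
    (bounded : All (λ x → ∣ ι (num x) - e ∣ ≤ ι b) xs) where

    far? : Decidable (λ x → ι τ ≤ ∣ ι (num x) - e ∣)
    far? x = ι τ ≤? ∣ ι (num x) - e ∣

    C = length xs
    T = sum (map num xs)
    R = length (filter far? xs)

    module _ (R*b<C : R ℕ.* b ℕ.< C) where

      ∣T-Ce∣≤ : ∣ ι T - ι C * e ∣ ≤ ι C * ι τ + ι C * ι τ
      ∣T-Ce∣≤ = begin
        ∣ ι T - ι C * e ∣                          ≡⟨ cong (λ z → ∣ z - ι C * e ∣) (ι-sum num xs) ⟩
        ∣ Sum xs (λ x → ι (num x)) - ι C * e ∣     ≡⟨ cong ∣_∣ (Sum-shift xs (λ x → ι (num x)) e) ⟨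
        ∣ Sum xs (λ x → ι (num x) - e) ∣           ≤⟨ ∣Sum∣≤Sum∣∣ xs (λ x → ι (num x) - e) ⟩
        Sum xs (λ x → ∣ ι (num x) - e ∣)           ≤⟨ Sum-split far? {τ = ι τ} {xs = xs} (0≤ι τ) bounded (λ x ¬far → <⇒≤ (≰⇒> ¬far)) ⟩
        ι C * ι τ + ι R * ι b                      ≡⟨ cong (ι C * ι τ +_) (ι-* R b) ⟨
        -- All far elements together contribute at most R b ≤ C, which is at most C τ because τ ≥ 1.
        ι C * ι τ + ι (R ℕ.* b)                    ≤⟨ +-monoʳ-≤ (ι C * ι τ) (ι-mono (ℕ.≤-trans (ℕ.<⇒≤ R*b<C) (ℕ.m≤m*n C τ {{ℕ.>-nonZero 1≤τ}}))) ⟩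
        ι C * ι τ + ι (C ℕ.* τ)                    ≡⟨ cong (ι C * ι τ +_) (ι-* C τ) ⟩
        ι C * ι τ + ι C * ι τ                      ∎
        where open ≤-Reasoning

      -- The mean lies within 2τ of `e`, so a distance of 4τ from the mean leaves 2τ from `e`.
      -- Everything is multiplied by C because the mean T / C is not formed.
      deviates⇒far : ∀ x → C ℕ.* (4 ℕ.* τ) ℕ.≤ ℕ.∣ C ℕ.* num x - T ∣ → ι τ ≤ ∣ ι (num x) - e ∣
      deviates⇒far x dev = *-cancelʳ (0<ι {C} (ℕ.≤-trans (ℕ.s≤s ℕ.z≤n) R*b<C)) (begin
        ι τ * ι C                                 ≤⟨ ≤-by (ι τ * ι C) (0≤* (0≤ι τ) (0≤ι C)) refl ⟩
        ι τ * ι C + ι τ * ι C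
          ≡⟨ solve 2 (λ c t → t :* c :+ t :* c := c :* (con (ι 4) :* t) :- (c :* t :+ c :* t)) refl (ι C) (ι τ) ⟩
        ι C * (ι 4 * ι τ) - v                     ≡⟨ cong (_- v) (trans (ι-* C (4 ℕ.* τ)) (cong (ι C *_) (ι-* 4 τ))) ⟨
        ι (C ℕ.* (4 ℕ.* τ)) - v                   ≤⟨ +-monoˡ-≤ (- v) (ι-mono dev) ⟩
        ι ℕ.∣ C ℕ.* num x - T ∣ - v               ≡⟨ cong (_- v) (trans (ι-∣-∣ (C ℕ.* num x) T) (cong (λ z → ∣ z - ι T ∣) (ι-* C (num x)))) ⟩
        ∣ ι C * ι (num x) - ι T ∣ - v
          ≡⟨ cong (λ z → ∣ z ∣ - v) (solve 4 (λ c n t e → c :* n :- t := c :* (n :- e) :- (t :- c :* e)) refl (ι C) (ι (num x)) (ι T) e) ⟩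
        ∣ ι C * d - (ι T - ι C * e) ∣ - v         ≤⟨ +-monoˡ-≤ (- v) (∣p-q∣≤∣p∣+∣q∣ (ι C * d) (ι T - ι C * e)) ⟩
        ∣ ι C * d ∣ + ∣ ι T - ι C * e ∣ - v       ≤⟨ +-monoˡ-≤ (- v) (+-monoʳ-≤ ∣ ι C * d ∣ ∣T-Ce∣≤) ⟩
        ∣ ι C * d ∣ + v - v                       ≡⟨ solve 2 (λ a v → a :+ v :- v := a) refl ∣ ι C * d ∣ v ⟩
        ∣ ι C * d ∣                               ≡⟨ trans (∣p*q∣≡∣p∣*∣q∣ (ι C) d) (cong (_* ∣ d ∣) (0≤p⇒∣p∣≡p (0≤ι C))) ⟩
        ι C * ∣ d ∣                               ≡⟨ *-comm (ι C) ∣ d ∣ ⟩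
        ∣ d ∣ * ι C                               ∎)
        where
        open ≤-Reasoning
        d = ι (num x) - e
        v = ι C * ι τ + ι C * ι τ

  -- Uniform regular hypergraphs of bounded codegree

  module _ {X : Set} (es : List X) {N m : ℕ} (1≤m : 1 ℕ.≤ m) (m≤N : m ℕ.≤ N)
    (P : X → Subset N) (k r κ : ℕ) (1≤κ : 1 ℕ.≤ κ)
    (uniform : ∀ i → size (P i) ≡ suc k)
    (regular : ∀ x → Sum es (λ i → ⟦ at (P i) x ⟧) ≡ ι r)
    (codegree : ∀ x y → x ≢ y → Sum es (λ i → ⟦ at (P i) x ⟧ * ⟦ at (P i) y ⟧) ≤ ι κ)
    (num : Subset N → ℕ) (num-eq : ∀ s → ι (num s) ≡ Sum es (λ i → mono (P i) s)) where

    private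
      C = numSubsets N m
      T = sum (map num (subsetsOfSize N m))

    bad : ℕ → ℕ → ℕ
    bad p q = length (filter (λ s → p ℕ.* C ℕ.<? q ℕ.* ℕ.∣ C ℕ.* num s - T ∣) (subsetsOfSize N m))

    -- R counts the sets at distance at least 36κmA from `𝔼 Φ`; recentring quadruples the distance,
    -- hence 144. In the first alternative these sets are a proportion of at least 1 / (4κm²), so
    -- the bound on R makes 2^A polynomial in N and the trivial bound on `bad` is good enough.
    few-far : ∀ A p q → 1 ℕ.≤ A → 1 ℕ.≤ q → A ℕ.* (q ℕ.* m ℕ.* (144 ℕ.* κ)) ℕ.≤ p →
      Σ ℕ λ R → R ℕ.* 2 ℕ.^ A ℕ.≤ 2 ℕ.* (suc N ℕ.* suc N) ℕ.* C × (C ℕ.≤ R ℕ.* (4 ℕ.* κ ℕ.* (m ℕ.* m)) ⊎ bad p q ℕ.≤ R)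
    few-far A p q 1≤A 1≤q le = R , large-deviation-count 1≤κ mean smth A far? (λ s _ far → far) , split (C ℕ.≤? R ℕ.* (4 ℕ.* κ ℕ.* (m ℕ.* m)))
      where
      1≤N = ℕ.≤-trans 1≤m m≤N
      t = proj₁ (quotient (ι m) N 1≤N)
      tN≡m : t * ι N ≡ ι m
      tN≡m = proj₂ (quotient (ι m) N 1≤N)
      0≤t : 0ℚ ≤ t
      0≤t = 0≤quotient {x = t} 1≤N tN≡m (0≤ι m)
      t≤1 : t ≤ 1ℚ
      t≤1 = *-cancelʳ (0<ι 1≤N) (subst₂ _≤_ (sym tN≡m) (sym (*-identityˡ (ι N))) (ι-mono m≤N))
      open Bernoulli t 0≤t t≤1
      open Hypergraph t 0≤t t≤1
      open Tail t 0≤t t≤1 tN≡m 1≤m m≤N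
      Φ : Subset N → ℚ
      Φ s = ι (num s)
      rep : Represents es Φ (λ _ → 1ℚ) P
      rep = mk λ s → trans (num-eq s) (Sum-cong es λ i → sym (*-identityˡ (mono (P i) s)))
      -- Each of the r edges through x has k further points, and each of them contributes a factor
      -- t.
      ρ = pow t k * ι r
      mean : Each (λ G → 𝔼 G ≡ ρ) (grad Φ)
      mean = means es rep λ x → trans
        (Sum-cong es λ i → trans (*-identityˡ (𝔼∂mono x (P i))) (trans (𝔼∂mono-uniform x (P i) (uniform i))
          -- The vanishing summand brings the term into the two-term form of `Sum-linear`.
          (solve 2 (λ a b → a :* b := a :* b :+ con 0ℚ :* b) refl (pow t k) ⟦ at (P i) x ⟧)))
        (trans (Sum-linear es (pow t k) 0ℚ (λ i → ⟦ at (P i) x ⟧) (λ i → ⟦ at (P i) x ⟧))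
        (trans (solve 2 (λ a b → a :* b :+ con 0ℚ :* b := a :* b) refl (pow t k) (Sum es λ i → ⟦ at (P i) x ⟧))
          (cong (pow t k *_) (regular x))))
        where
        𝔼mono-size : ∀ {n} (P : Vec Bool n) → 𝔼mono P ≡ pow t (size P)
        𝔼mono-size [] = refl
        𝔼mono-size (true ∷ P) = cong (t *_) (𝔼mono-size P)
        𝔼mono-size (false ∷ P) = trans (*-identityˡ (𝔼mono P)) (𝔼mono-size P)
        𝔼∂mono-uniform : ∀ {n k} x (P : Vec Bool n) → size P ≡ suc k → 𝔼∂mono x P ≡ pow t k * ⟦ at P x ⟧
        𝔼∂mono-uniform zero (true ∷ P) refl = trans (*-identityˡ (𝔼mono P)) (trans (𝔼mono-size P) (sym (*-identityʳ _)))
        𝔼∂mono-uniform {k = k} zero (false ∷ P) eq = trans (*-zeroˡ (𝔼mono P)) (sym (*-zeroʳ (pow t k)))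
        -- The head is the only point of the edge, so x lies outside it and both sides vanish.
        𝔼∂mono-uniform {k = zero} (suc x) (true ∷ P) eq = trans (cong (t *_) (empty x P (ℕ.suc-injective eq)))
          (trans (*-zeroʳ t) (sym (trans (*-identityˡ ⟦ at P x ⟧) (at-empty x P (ℕ.suc-injective eq)))))
          where
          at-empty : ∀ {n} x (P : Vec Bool n) → size P ≡ 0 → ⟦ at P x ⟧ ≡ 0ℚ
          at-empty zero (false ∷ P) _ = refl
          at-empty (suc x) (false ∷ P) eq = at-empty x P eq
          empty : ∀ {n} x (P : Vec Bool n) → size P ≡ 0 → 𝔼∂mono x P ≡ 0ℚ
          empty zero (false ∷ P) _ = *-zeroˡ (𝔼mono P)
          empty (suc x) (false ∷ P) eq = trans (*-identityˡ (𝔼∂mono x P)) (empty x P eq)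
        𝔼∂mono-uniform {k = suc k} (suc x) (true ∷ P) eq = trans (cong (t *_) (𝔼∂mono-uniform x P (ℕ.suc-injective eq)))
          (sym (*-assoc t (pow t k) ⟦ at P x ⟧))
        𝔼∂mono-uniform (suc x) (false ∷ P) eq = trans (*-identityˡ (𝔼∂mono x P)) (𝔼∂mono-uniform x P eq)
      smth : Each (λ G → Each (Bounded (ι κ)) (grad G)) (grad Φ)
      smth = smooth es rep (λ _ → 0≤1) λ x y x≢y → ≤-trans
        (≤-reflexive (Sum-cong es λ i → cong (_* ⟦ at (P i) y ⟧) (*-identityˡ ⟦ at (P i) x ⟧))) (codegree x y x≢y)
      τ = 36 ℕ.* κ ℕ.* (m ℕ.* A)
      sizes = all-filter (λ s → size s ℕ.≟ m) (allSubsets N)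
      open Recentre (subsetsOfSize N m) num (𝔼 Φ) (4 ℕ.* κ ℕ.* (m ℕ.* m)) τ
        (ℕ.*-mono-≤ (ℕ.*-mono-≤ {1} {36} (ℕ.s≤s ℕ.z≤n) 1≤κ) (ℕ.*-mono-≤ 1≤m 1≤A))
        (All.map (λ {s} size≡m → deviation≤ 1≤κ mean smth s size≡m) sizes) hiding (C; T)
      rearrange : ∀ q m κ A C → q ℕ.* (C ℕ.* (4 ℕ.* (36 ℕ.* κ ℕ.* (m ℕ.* A)))) ≡ A ℕ.* (q ℕ.* m ℕ.* (144 ℕ.* κ)) ℕ.* C
      rearrange = solve-∀
      split : Dec (C ℕ.≤ R ℕ.* (4 ℕ.* κ ℕ.* (m ℕ.* m))) → C ℕ.≤ R ℕ.* (4 ℕ.* κ ℕ.* (m ℕ.* m)) ⊎ bad p q ℕ.≤ R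
      split (yes C≤) = inj₁ C≤
      split (no C≰) = inj₂ (length-filter-mono (λ s → p ℕ.* C ℕ.<? q ℕ.* ℕ.∣ C ℕ.* num s - T ∣) far?
        (All.map (λ {s} _ dev → deviates⇒far (ℕ.≰⇒> C≰) s (ℕ.*-cancelˡ-≤ q {{ℕ.>-nonZero 1≤q}}
          (ℕ.≤-trans (ℕ.≤-reflexive (rearrange q m κ A C)) (ℕ.≤-trans (ℕ.*-monoˡ-≤ C le) (ℕ.<⇒≤ dev))))) sizes))

  -- Double counting with indicator sums

  Sum-zero : ∀ {X : Set} {h : X → ℚ} {xs : List X} → All (λ x → h x ≡ 0ℚ) xs → Sum xs h ≡ 0ℚ
  Sum-zero [] = refl
  Sum-zero {h = h} {x ∷ xs} (eq ∷ eqs) = trans (cong₂ _+_ eq (Sum-zero eqs)) (+-identityˡ 0ℚ)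

  Sum-single : ∀ {X : Set} {h : X → ℚ} {xs : List X} {x₀} → Unique xs → x₀ ∈ xs → h x₀ ≡ 1ℚ →
    (∀ x → x ≢ x₀ → h x ≡ 0ℚ) → Sum xs h ≡ 1ℚ
  Sum-single (x∉xs ∷ uniq) (here refl) h≡1 h≡0 =
    trans (cong₂ _+_ h≡1 (Sum-zero (All.map (λ x≢y → h≡0 _ λ { refl → x≢y refl }) x∉xs))) (+-identityʳ 1ℚ)
  Sum-single {h = h} {x ∷ xs} (x∉xs ∷ uniq) (there x₀∈) h≡1 h≡0 =
    trans (cong₂ _+_ (h≡0 x (λ { refl → All.lookup x∉xs x₀∈ refl })) (Sum-single uniq x₀∈ h≡1 h≡0)) (+-identityˡ 1ℚ)

  Sum-at-most-one : ∀ {X : Set} {h : X → ℚ} {xs : List X} → Unique xs → (∀ x → h x ≡ 0ℚ ⊎ h x ≡ 1ℚ) →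
    (∀ x y → h x ≡ 1ℚ → h y ≡ 1ℚ → x ≡ y) → Sum xs h ≤ 1ℚ
  Sum-at-most-one [] _ _ = 0≤1
  Sum-at-most-one {h = h} {x ∷ xs} (x∉xs ∷ uniq) dich inj with dich x
  ... | inj₁ h≡0 = ≤-trans (≤-reflexive (trans (cong (_+ Sum xs h) h≡0) (+-identityˡ (Sum xs h)))) (Sum-at-most-one uniq dich inj)
  ... | inj₂ h≡1 = ≤-reflexive (trans (cong₂ _+_ h≡1 (Sum-zero (All.map others x∉xs))) (+-identityʳ 1ℚ))
    where
    others : ∀ {y} → x ≢ y → h y ≡ 0ℚ
    others {y} x≢y with dich y
    ... | inj₁ eq = eq
    ... | inj₂ eq = ⊥-elim (x≢y (inj x y h≡1 eq))

  Sum-* : ∀ {X : Set} (xs : List X) (h : X → ℚ) a → Sum xs h * a ≡ Sum xs (λ x → h x * a)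
  Sum-* [] h a = *-zeroˡ a
  Sum-* (x ∷ xs) h a = trans (*-distribʳ-+ a (h x) (Sum xs h)) (cong (h x * a +_) (Sum-* xs h a))

  Sum-+ : ∀ {X : Set} (xs : List X) (h g : X → ℚ) → Sum xs (λ x → h x + g x) ≡ Sum xs h + Sum xs g
  Sum-+ [] h g = sym (+-identityˡ 0ℚ)
  Sum-+ (x ∷ xs) h g = trans (cong (h x + g x +_) (Sum-+ xs h g))
    (solve 4 (λ a b c d → a :+ b :+ (c :+ d) := a :+ c :+ (b :+ d)) refl (h x) (g x) (Sum xs h) (Sum xs g))

  Sum-swap : ∀ {X Y : Set} (xs : List X) (ys : List Y) (h : X → Y → ℚ) →
    Sum xs (λ x → Sum ys (h x)) ≡ Sum ys (λ y → Sum xs (λ x → h x y))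
  Sum-swap [] ys h = sym (Sum-zero {xs = ys} (All.universal (λ _ → refl) ys))
  Sum-swap (x ∷ xs) ys h = trans (cong (Sum ys (h x) +_) (Sum-swap xs ys h)) (sym (Sum-+ ys (h x) (λ y → Sum xs (λ x → h x y))))

  Sum-cartesianProduct : ∀ {X Y : Set} (xs : List X) (ys : List Y) (h : X × Y → ℚ) →
    Sum (cartesianProduct xs ys) h ≡ Sum xs (λ x → Sum ys (λ y → h (x , y)))
  Sum-cartesianProduct [] ys h = refl
  Sum-cartesianProduct (x ∷ xs) ys h = trans (Sum-++ (map (x ,_) ys) (cartesianProduct xs ys) h)
    (cong₂ _+_ (Sum-map (x ,_) ys h) (Sum-cartesianProduct xs ys h))

  upTo≡map-toℕ : ∀ n → upTo n ≡ map toℕ (allFin n)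
  upTo≡map-toℕ n = go n (λ i → i) (λ i → i) (λ _ → refl)
    where
    go : ∀ {N} n (φ : ℕ → ℕ) (ψ : Fin n → Fin N) → (∀ i → φ (toℕ i) ≡ toℕ (ψ i)) → applyUpTo φ n ≡ map toℕ (tabulate ψ)
    go zero φ ψ eq = refl
    go (suc n) φ ψ eq = cong₂ _∷_ (eq zero) (go n (λ i → φ (suc i)) (λ i → ψ (suc i)) (λ i → eq (suc i)))

  δᶠ : ∀ {n} → Fin n → Fin n → ℚ
  δᶠ x y = δ (toℕ x) (toℕ y)

  δᶠ-≢ : ∀ {n} {x y : Fin n} → x ≢ y → δᶠ x y ≡ 0ℚ
  δᶠ-≢ {x = x} {y} x≢y = δ-≢ (toℕ x) (toℕ y) λ eq → x≢y (toℕ-injective eq)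

  δᶠ-dichotomy : ∀ {n} (x y : Fin n) → (x ≡ y × δᶠ x y ≡ 1ℚ) ⊎ δᶠ x y ≡ 0ℚ
  δᶠ-dichotomy x y with x Fin.≟ y
  ... | yes refl = inj₁ (refl , δ-refl (toℕ x))
  ... | no x≢y = inj₂ (δᶠ-≢ x≢y)

  -- Edges built from their points

  insert : ∀ {n} → Fin n → Vec Bool n → Vec Bool n
  insert x S = S [ x ]≔ true

  at-insert : ∀ {n} (x : Fin n) S y → at S x ≡ false → ⟦ at (insert x S) y ⟧ ≡ δᶠ x y + ⟦ at S y ⟧
  at-insert zero (false ∷ S) zero _ = refl
  at-insert zero (b ∷ S) (suc y) _ = sym (+-identityˡ ⟦ at S y ⟧)
  at-insert (suc x) (b ∷ S) zero _ = sym (+-identityˡ ⟦ b ⟧)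
  at-insert (suc x) (b ∷ S) (suc y) eq = at-insert x S y eq

  size-insert : ∀ {n} (x : Fin n) S → at S x ≡ false → size (insert x S) ≡ suc (size S)
  size-insert zero (false ∷ S) _ = refl
  size-insert (suc x) (true ∷ S) eq = cong suc (size-insert x S eq)
  size-insert (suc x) (false ∷ S) eq = size-insert x S eq

  -- If x already lies in S, idempotence of `⟦_⟧` absorbs the repeated factor.
  mono-insert : ∀ {n} (x : Fin n) S s → mono (insert x S) s ≡ ⟦ lookup s x ⟧ * mono S s
  mono-insert zero (true ∷ S) (true ∷ s) = sym (*-identityˡ (1ℚ * mono S s))
  mono-insert zero (true ∷ S) (false ∷ s) = trans (*-zeroˡ (mono S s)) (sym (*-zeroˡ (0ℚ * mono S s)))
  mono-insert zero (false ∷ S) (b ∷ s) = cong (⟦ b ⟧ *_) (sym (*-identityˡ (mono S s)))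
  mono-insert (suc x) (p ∷ S) (b ∷ s) = trans (cong (factor p b *_) (mono-insert x S s))
    (solve 3 (λ a b c → a :* (b :* c) := b :* (a :* c)) refl (factor p b) ⟦ lookup s x ⟧ (mono S s))

  empty : ∀ n → Vec Bool n
  empty n = Vec.replicate n false

  at-empty : ∀ {n} (x : Fin n) → at (empty n) x ≡ false
  at-empty {suc n} zero = refl
  at-empty {suc n} (suc x) = at-empty x

  size-empty : ∀ n → size (empty n) ≡ 0
  size-empty zero = refl
  size-empty (suc n) = size-empty n

  mono-empty : ∀ {n} (s : Vec Bool n) → mono (empty n) s ≡ 1ℚ
  mono-empty [] = refl
  mono-empty (b ∷ s) = trans (*-identityˡ (mono (empty _) s)) (mono-empty s)

  module _ {J : Set} {n : ℕ} (pos : J → Fin n) where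

    points : List J → Vec Bool n
    points = foldr (λ j → insert (pos j)) (empty n)

    mono-points : ∀ js s → mono (points js) s ≡ ι (product (map (λ j → indicator (lookup s (pos j))) js))
    mono-points [] s = mono-empty s
    mono-points (j ∷ js) s = trans (mono-insert (pos j) (points js) s)
      (trans (cong₂ _*_ (⟦⟧≡ι (lookup s (pos j))) (mono-points js s)) (sym (ι-* (indicator (lookup s (pos j))) _)))
      where
      ⟦⟧≡ι : ∀ b → ⟦ b ⟧ ≡ ι (indicator b)
      ⟦⟧≡ι true = refl
      ⟦⟧≡ι false = refl

    module _ (pos-injective : ∀ i j → pos i ≡ pos j → i ≡ j) where

      -- Mutual with `fresh`: inserting a point adds to the incidences only if the point is new, and
      -- that is read off from the incidence sum of the shorter list, which vanishes there by
      -- injectivity.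
      at-points : ∀ {js} → Unique js → ∀ y → ⟦ at (points js) y ⟧ ≡ Sum js (λ j → δᶠ (pos j) y)
      fresh : ∀ {j js} → All (j ≢_) js → Unique js → at (points js) (pos j) ≡ false

      at-points {[]} [] y = cong ⟦_⟧ (at-empty y)
      at-points {j ∷ js} (j∉js ∷ uniq) y =
        trans (at-insert (pos j) (points js) y (fresh j∉js uniq)) (cong (δᶠ (pos j) y +_) (at-points uniq y))

      fresh {j} {js} j∉js uniq = ⟦⟧≡0⇒false (trans (at-points uniq (pos j))
        (Sum-zero (All.map (λ {i} j≢i → δᶠ-≢ λ eq → j≢i (sym (pos-injective i j eq))) j∉js)))
        where
        ⟦⟧≡0⇒false : ∀ {b} → ⟦ b ⟧ ≡ 0ℚ → b ≡ false
        ⟦⟧≡0⇒false {false} _ = refl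

      size-points : ∀ {js} → Unique js → size (points js) ≡ length js
      size-points [] = size-empty n
      size-points {j ∷ js} (j∉js ∷ uniq) = trans (size-insert (pos j) (points js) (fresh j∉js uniq)) (cong suc (size-points uniq))

  -- The hypergraph of progressions

  module Progressions {k n : ℕ} (N-prime : Prime (suc n)) (k<N : k ℕ.< suc n) where

    Index : Set
    Index = Fin (suc n) × Fin (n ℕ./ 2)

    indices : List Index
    indices = cartesianProduct (allFin (suc n)) (allFin (n ℕ./ 2))

    difference : Fin (n ℕ./ 2) → ℕ
    difference d = suc (toℕ d)

    difference<N : ∀ d → difference d ℕ.< suc n
    difference<N d = ℕ.s≤s (ℕ.≤-trans (toℕ<n d) (ℕ.m/n≤m n 2))

    position : Index → Fin k → Fin (suc n)
    position (x , d) j = term x (difference d) (toℕ j)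

    j<N : (j : Fin k) → toℕ j ℕ.< suc n
    j<N j = ℕ.<-trans (toℕ<n j) k<N

    position-injective : ∀ a i j → position a i ≡ position a j → i ≡ j
    position-injective (x , d) i j eq =
      toℕ-injective (term-injective-j N-prime {x} (difference<N d) (λ ()) (j<N i) (j<N j) eq)

    edge : Index → Subset (suc n)
    edge a = points (position a) (allFin k)

    size-edge : ∀ a → size (edge a) ≡ k
    size-edge a = trans (size-points (position a) (position-injective a) (allFin⁺ k)) (length-tabulate {n = k} (λ j → j))

    at-edge : ∀ a y → ⟦ at (edge a) y ⟧ ≡ Sum (allFin k) (λ j → δᶠ (position a j) y)
    at-edge a y = at-points (position a) (position-injective a) (allFin⁺ k) y

    ι-numAP : ∀ s → ι (numAP k (suc n) s) ≡ Sum indices (λ a → mono (edge a) s)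
    ι-numAP s = trans (ι-sum (λ x → sum (map (λ d → apIn k n s x (suc d)) (upTo (n ℕ./ 2)))) (allFin (suc n))) (trans
      (Sum-cong (allFin (suc n)) λ x → trans (cong (λ l → ι (sum (map (λ d → apIn k n s x (suc d)) l))) (upTo≡map-toℕ (n ℕ./ 2)))
        (trans (cong (λ l → ι (sum l)) (sym (map-∘ (allFin (n ℕ./ 2)))))
        (trans (ι-sum _ (allFin (n ℕ./ 2))) (Sum-cong (allFin (n ℕ./ 2)) λ d →
           trans (cong (λ l → ι (product (map (λ j → indicator (lookup s (term x (difference d) j))) l))) (upTo≡map-toℕ k))
           (trans (cong (λ l → ι (product l)) (sym (map-∘ (allFin k)))) (sym (mono-points (position (x , d)) (allFin k) s)))))))
      (sym (Sum-cartesianProduct (allFin (suc n)) (allFin (n ℕ./ 2)) (λ a → mono (edge a) s))))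

    -- For a given difference and a given position j there is exactly one starting point whose j-th
    -- term is y.
    degree : ∀ y → Sum indices (λ a → ⟦ at (edge a) y ⟧) ≡ ι ((n ℕ./ 2) ℕ.* k)
    degree y = trans (Sum-cong indices λ a → at-edge a y) (trans
      (Sum-cartesianProduct (allFin (suc n)) (allFin (n ℕ./ 2)) (λ a → Sum (allFin k) (λ j → δᶠ (position a j) y)))
      (trans (Sum-swap (allFin (suc n)) (allFin (n ℕ./ 2)) (λ x d → Sum (allFin k) (λ j → δᶠ (position (x , d) j) y)))
      (trans (Sum-cong (allFin (n ℕ./ 2)) λ d → trans (Sum-swap (allFin (suc n)) (allFin k) (λ x j → δᶠ (position (x , d) j) y))
        (trans (Sum-cong (allFin k) λ j → one d j) (Sum-ones k)))
      (trans (Sum-const (allFin (n ℕ./ 2)) (ι k)) (trans (cong (λ l → ι l * ι k) (length-tabulate {n = n ℕ./ 2} (λ j → j)))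
        (sym (ι-* (n ℕ./ 2) k)))))))
      where
      Sum-ones : ∀ k → Sum (allFin k) (λ _ → 1ℚ) ≡ ι k
      Sum-ones k = trans (Sum-const (allFin k) 1ℚ) (trans (*-identityʳ _) (cong ι (length-tabulate {n = k} (λ j → j))))
      one : ∀ d j → Sum (allFin (suc n)) (λ x → δᶠ (position (x , d) j) y) ≡ 1ℚ
      one d j with term-surjective-x y (difference d) (toℕ j)
      ... | x₀ , eq = Sum-single {h = λ x → δᶠ (position (x , d) j) y} (allFin⁺ (suc n)) (∈-allFin x₀) (trans (cong (λ z → δᶠ z y) eq) (δ-refl (toℕ y)))
        (λ x x≢x₀ → δᶠ-≢ λ eq′ → x≢x₀ (term-injective-x (difference d) (toℕ j) (trans eq′ (sym eq))))

    -- Each of the k² pairs of positions (i, j) admits at most one progression with u at i and v at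
    -- j: the two terms determine the difference and then the start. Pairs with i = j admit none,
    -- since u ≠ v.
    codegree≤ : ∀ u v → u ≢ v → Sum indices (λ a → ⟦ at (edge a) u ⟧ * ⟦ at (edge a) v ⟧) ≤ ι (k ℕ.* k)
    codegree≤ u v u≢v = begin
      Sum indices (λ a → ⟦ at (edge a) u ⟧ * ⟦ at (edge a) v ⟧)
        ≡⟨ Sum-cong indices (λ a → trans (cong₂ _*_ (at-edge a u) (at-edge a v)) (expand a)) ⟩
      Sum indices (λ a → Sum K (λ i → Sum K (λ j → pair i j a)))
        ≡⟨ trans (Sum-swap indices K (λ a i → Sum K (λ j → pair i j a))) (Sum-cong K λ i → Sum-swap indices K (λ a j → pair i j a)) ⟩
      Sum K (λ i → Sum K (λ j → Sum indices (pair i j)))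
        ≤⟨ Sum-mono K (λ i → Sum-mono K λ j → at-most-one i j) ⟩
      Sum K (λ i → Sum K (λ j → 1ℚ))
        ≡⟨ trans (Sum-cong K λ i → Sum-const K 1ℚ) (Sum-const K _) ⟩
      ι (length K) * (ι (length K) * 1ℚ)
        ≡⟨ trans (cong (λ l → ι l * (ι l * 1ℚ)) (length-tabulate {n = k} (λ j → j))) (trans (cong (ι k *_) (*-identityʳ (ι k))) (sym (ι-* k k))) ⟩
      ι (k ℕ.* k) ∎
      where
      open ≤-Reasoning
      K = allFin k
      pair : Fin k → Fin k → Index → ℚ
      pair i j a = δᶠ (position a i) u * δᶠ (position a j) v
      expand : ∀ a → Sum K (λ i → δᶠ (position a i) u) * Sum K (λ j → δᶠ (position a j) v) ≡ Sum K (λ i → Sum K (λ j → pair i j a))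
      expand a = trans (Sum-* K (λ i → δᶠ (position a i) u) _) (Sum-cong K λ i →
        trans (*-comm (δᶠ (position a i) u) (Sum K (λ j → δᶠ (position a j) v))) (trans (Sum-* K (λ j → δᶠ (position a j) v) (δᶠ (position a i) u))
          (Sum-cong K λ j → *-comm (δᶠ (position a j) v) (δᶠ (position a i) u))))
      pair-dichotomy : ∀ i j a → pair i j a ≡ 0ℚ ⊎ (pair i j a ≡ 1ℚ × position a i ≡ u × position a j ≡ v)
      pair-dichotomy i j a with δᶠ-dichotomy (position a i) u | δᶠ-dichotomy (position a j) v
      ... | inj₁ (p , e) | inj₁ (q , e′) = inj₂ (cong₂ _*_ e e′ , p , q)
      ... | inj₂ e | _ = inj₁ (trans (cong (_* δᶠ (position a j) v) e) (*-zeroˡ (δᶠ (position a j) v)))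
      ... | inj₁ _ | inj₂ e = inj₁ (trans (cong (δᶠ (position a i) u *_) e) (*-zeroʳ (δᶠ (position a i) u)))
      pair-zero-or-one : ∀ i j a → pair i j a ≡ 0ℚ ⊎ pair i j a ≡ 1ℚ
      pair-zero-or-one i j a with pair-dichotomy i j a
      ... | inj₁ e = inj₁ e
      ... | inj₂ (e , _) = inj₂ e
      pair≡1⇒ : ∀ i j a → pair i j a ≡ 1ℚ → position a i ≡ u × position a j ≡ v
      pair≡1⇒ i j a e with pair-dichotomy i j a
      ... | inj₂ (_ , pq) = pq
      ... | inj₁ e0 with trans (sym e) e0
      ...   | ()
      at-most-one : ∀ i j → Sum indices (pair i j) ≤ 1ℚ
      at-most-one i j = Sum-at-most-one (cartesianProduct⁺ (allFin⁺ (suc n)) (allFin⁺ (n ℕ./ 2))) (pair-zero-or-one i j) same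
        where
        same : ∀ a b → pair i j a ≡ 1ℚ → pair i j b ≡ 1ℚ → a ≡ b
        same a@(x , d) b@(x′ , d′) ea eb with pair≡1⇒ i j a ea | pair≡1⇒ i j b eb
        ... | p , q | p′ , q′ with toℕ-injective (ℕ.suc-injective (two-terms-determine-difference N-prime {x} {x′} (difference<N d) (difference<N d′) (j<N i) (j<N j)
               (λ i≡j → u≢v (trans (sym p) (trans (cong (term x (difference d)) i≡j) q))) p q p′ q′))
        ... | refl with term-injective-x {x = x} {x′} (difference d) (toℕ i) (trans p (sym p′))
        ... | refl = refl

-- Natural-number form of the bound

open import Data.Nat using (ℕ; zero; suc; _+_; _*_; _^_; _≤_; _<_; _/_; _%_; z≤n; s≤s; NonZero; >-nonZero)
open import Data.Nat.DivMod using (m≡m%n+[m/n]*n; m%n<n; m/n*n≤m)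
open import Data.Nat.Properties
open Deviation using (few-far; module Progressions)

m<[1+m/n]*n : ∀ m n .{{_ : NonZero n}} → m < suc (m / n) * n
m<[1+m/n]*n m n = begin-strict
  m                       ≡⟨ m≡m%n+[m/n]*n m n ⟩
  m % n + m / n * n       <⟨ +-monoˡ-< (m / n * n) (m%n<n m n) ⟩
  suc (m / n) * n         ∎
  where open ≤-Reasoning

^-distribʳ-* : ∀ e a b → (a * b) ^ e ≡ a ^ e * b ^ e
^-distribʳ-* zero a b = refl
^-distribʳ-* (suc e) a b = trans (cong (a * b *_) (^-distribʳ-* e a b)) ([m*n]*[o*p]≡[m*o]*[n*p] a b (a ^ e) (b ^ e))

raise-to-e : ∀ {b C M A p e} → p ≤ A * e → b * 2 ^ A ≤ M * C → b ^ e * 2 ^ p ≤ M ^ e * C ^ e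
raise-to-e {b} {C} {M} {A} {p} {e} p≤Ae le = begin
  b ^ e * 2 ^ p           ≤⟨ *-monoʳ-≤ (b ^ e) (^-monoʳ-≤ 2 p≤Ae) ⟩
  b ^ e * 2 ^ (A * e)     ≡⟨ cong (b ^ e *_) (^-*-assoc 2 A e) ⟨
  b ^ e * (2 ^ A) ^ e     ≡⟨ ^-distribʳ-* e b (2 ^ A) ⟨
  (b * 2 ^ A) ^ e         ≤⟨ ^-monoˡ-≤ e le ⟩
  (M * C) ^ e             ≡⟨ ^-distribʳ-* e M C ⟩
  M ^ e * C ^ e           ∎
  where open ≤-Reasoning

-- The left side is 16 k² m² (N + 1)². The first three factors are at most N² each, and the last is
-- at most N⁴.
polynomial-bound : ∀ {N m k} → 4 ≤ N → m ≤ N → k ≤ N →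
  2 * (4 * (k * k) * (m * m) * (2 * (suc N * suc N))) ≤ N ^ 10
polynomial-bound {N} {m} {k} 4≤N m≤N k≤N = begin
  2 * (4 * (k * k) * (m * m) * (2 * (suc N * suc N)))  ≡⟨ lhs k m (suc N) ⟩
  4 * 4 * (k * k) * (m * m) * (suc N * suc N)
    ≤⟨ *-mono-≤ (*-mono-≤ (*-mono-≤ (*-mono-≤ 4≤N 4≤N) (*-mono-≤ k≤N k≤N)) (*-mono-≤ m≤N m≤N)) (*-mono-≤ 1+N≤N² 1+N≤N²) ⟩
  N * N * (N * N) * (N * N) * (N * N * (N * N))        ≡⟨ rhs N ⟩
  N ^ 10                                               ∎
  where
  open ≤-Reasoning
  1+N≤N² : suc N ≤ N * N
  1+N≤N² = ≤-trans (+-mono-≤ {1} {N} (≤-trans (s≤s z≤n) 4≤N) (m≤m+n N 0)) (*-monoˡ-≤ N (≤-trans (s≤s (s≤s z≤n)) 4≤N))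
  lhs : ∀ k m n → 2 * (4 * (k * k) * (m * m) * (2 * (n * n))) ≡ 4 * 4 * (k * k) * (m * m) * (n * n)
  lhs = solve-∀
  rhs : ∀ N → N * N * (N * N) * (N * N) * (N * N * (N * N)) ≡ N * (N * (N * (N * (N * (N * (N * (N * (N * (N * 1)))))))))
  rhs = solve-∀

-- The exponent is `suc A` because A will be p / e rounded down, and only p < (A + 1) e is
-- available. The additional factor 2 goes into N^10.
badCount*2^ : ∀ {k n} → 3 ≤ k → Prime (suc n) → k < suc n → ∀ {m} → 1 ≤ m → m ≤ suc n →
  ∀ A p q → 1 ≤ q → A * (q * m * (144 * (k * k))) ≤ p →
  badCount k (suc n) m p q * 2 ^ suc A ≤ suc n ^ 10 * numSubsets (suc n) m
-- For A = 0 the threshold τ of the recentring would be 0; the trivial bound by all m-subsets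
-- suffices.
badCount*2^ {k} {n} 3≤k N-prime k<N {m} 1≤m m≤N zero p q 1≤q _ = begin
  badCount k (suc n) m p q * 2 ^ 1                  ≤⟨ *-mono-≤ (length-filter _ (subsetsOfSize (suc n) m)) 2≤N^10 ⟩
  numSubsets (suc n) m * suc n ^ 10                 ≡⟨ *-comm (numSubsets (suc n) m) (suc n ^ 10) ⟩
  suc n ^ 10 * numSubsets (suc n) m                 ∎
  where
  open ≤-Reasoning
  2≤N^10 : 2 ^ 1 ≤ suc n ^ 10
  2≤N^10 = ≤-trans (^-monoˡ-≤ 1 (≤-trans (s≤s (s≤s z≤n)) (≤-trans 3≤k (<⇒≤ k<N)))) (^-monoʳ-≤ (suc n) {1} {10} (s≤s z≤n))
badCount*2^ {k@(suc k₀)} {n} 3≤k N-prime k<N {m} 1≤m m≤N A@(suc _) p q 1≤q le = conclude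
  (few-far indices 1≤m m≤N edge k₀ (n / 2 * k) (k * k) (s≤s z≤n) size-edge degree codegree≤ (numAP k (suc n)) ι-numAP
    A p q (s≤s z≤n) 1≤q le)
  where
  open ≤-Reasoning
  open Progressions {k} {n} N-prime k<N
  C = numSubsets (suc n) m
  D = 2 * (suc (suc n) * suc (suc n))
  E = 4 * (k * k) * (m * m)
  1≤E : 1 ≤ E
  1≤E = *-mono-≤ {1} {4 * (k * k)} (s≤s z≤n) (*-mono-≤ 1≤m 1≤m)
  2ED≤N^10 : 2 * (E * D) ≤ suc n ^ 10
  2ED≤N^10 = polynomial-bound {m = m} {k} (≤-trans (s≤s 3≤k) k<N) m≤N (<⇒≤ k<N)
  rearrange : ∀ R E x → R * E * (2 * x) ≡ 2 * E * (R * x)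
  rearrange = solve-∀
  reassociate : ∀ E D C → 2 * E * (D * C) ≡ 2 * (E * D) * C
  reassociate = solve-∀
  -- Both alternatives of `few-far` give b ≤ R E: one through b ≤ C ≤ R E, the other through b ≤ R
  -- and E ≥ 1.
  via-R*E : ∀ {R b} → b ≤ R * E → R * 2 ^ A ≤ D * C → b * 2 ^ suc A ≤ suc n ^ 10 * C
  via-R*E {R} {b} b≤R*E R*2^A≤ = begin
    b * (2 * 2 ^ A)           ≤⟨ *-monoˡ-≤ (2 * 2 ^ A) b≤R*E ⟩
    R * E * (2 * 2 ^ A)       ≡⟨ rearrange R E (2 ^ A) ⟩
    2 * E * (R * 2 ^ A)       ≤⟨ *-monoʳ-≤ (2 * E) R*2^A≤ ⟩
    2 * E * (D * C)           ≡⟨ reassociate E D C ⟩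
    2 * (E * D) * C           ≤⟨ *-monoˡ-≤ C 2ED≤N^10 ⟩
    suc n ^ 10 * C            ∎
  conclude : (∃ λ R → R * 2 ^ A ≤ D * C × (C ≤ R * E ⊎ badCount k (suc n) m p q ≤ R)) →
    badCount k (suc n) m p q * 2 ^ suc A ≤ suc n ^ 10 * C
  conclude (R , R*2^A≤ , inj₁ C≤R*E) = via-R*E {R} (≤-trans (length-filter _ (subsetsOfSize (suc n) m)) C≤R*E) R*2^A≤
  conclude (R , R*2^A≤ , inj₂ bad≤R) = via-R*E {R} (≤-trans bad≤R (m≤m*n R E {{>-nonZero 1≤E}})) R*2^A≤

theorem5p1 : ∀ (k : ℕ) → 3 ≤ k →
    ∃ λ (c₁ : ℕ) → ∃ λ (K : ℕ) → 1 ≤ K ×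
    (∀ (N : ℕ) → Prime N → k < N → ∀ (m : ℕ) → 1 ≤ m → m ≤ N →
    ∀ (p q : ℕ) → 1 ≤ p → 1 ≤ q →
    badCount k N m p q ^ (q * m * K) * 2 ^ p
    ≤ N ^ (c₁ * (q * m * K)) * numSubsets N m ^ (q * m * K))
-- With a = p / q and e = q m K, the factor 2^(-p / e) is exp(-c₂ a / m) for c₂ = ln 2 / K. The
-- constant 144 k² is that of `few-far` with κ = k².
theorem5p1 k 3≤k = 10 , K , 1≤K , main
  where
  K = 144 * (k * k)
  1≤k = ≤-trans (s≤s z≤n) 3≤k
  1≤K : 1 ≤ K
  1≤K = *-mono-≤ {1} {144} (s≤s z≤n) (*-mono-≤ 1≤k 1≤k)
  main : ∀ N → Prime N → k < N → ∀ m → 1 ≤ m → m ≤ N → ∀ p q → 1 ≤ p → 1 ≤ q →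
    badCount k N m p q ^ (q * m * K) * 2 ^ p ≤ N ^ (10 * (q * m * K)) * numSubsets N m ^ (q * m * K)
  main (suc n) N-prime k<N m 1≤m m≤N p q _ 1≤q = ≤-trans
    (raise-to-e {badCount k (suc n) m p q} {numSubsets (suc n) m} {suc n ^ 10} {suc (p / e)} {p} {e} (<⇒≤ (m<[1+m/n]*n p e))
      (badCount*2^ 3≤k N-prime k<N 1≤m m≤N (p / e) p q 1≤q (m/n*n≤m p e)))
    (≤-reflexive (cong (_* numSubsets (suc n) m ^ e) (^-*-assoc (suc n) 10 e)))
    where
    e = q * m * K
    instance
      e≢0 : NonZero e
      e≢0 = >-nonZero (*-mono-≤ (*-mono-≤ 1≤q 1≤m) 1≤K)
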